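{- Let $p>3$ be a prime and $m,x\in\mathbb Z_p$ with $m\not\equiv0,\pm1\pmod p$. Then $$\sum_{n=0}^{p-1}\frac{V_n(x)}{m^n}\equiv\Big(\sum_{k=0}^{p-1}\frac{G_k(x)}{m^k}\Big)^2\equiv\sum_{k=0}^{p-1}\frac{\binom{2k}k\binom xk\binom{ -1-x}k}{(2-m-1/m)^k}\pmod p.$$ Consequently, for $m\in\mathbb Z_p$, $m\not\equiv0\pmod p$: $\sum_{n=0}^{p-1}\frac{V_n^{(3)}}{m^n}\equiv\big(\sum_{k=0}^{p-1}\frac{G_k^{(3)}}{m^k}\big)^2\equiv\sum_{k=0}^{p-1}\frac{\binom{2k}k^2\binom{3k}k}{(54-m-729/m)^k}\pmod p$ for $m\not\equiv\pm27\pmod p$; $\sum_{n=0}^{p-1}\frac{V_n^{(4)}}{m^n}\equiv\big(\sum_{k=0}^{p-1}\frac{G_k^{(4)}}{m^k}\big)^2\equiv\sum_{k=0}^{p-1}\frac{\binom{2k}k^2\binom{4k}{2k}}{(128-m-4096/m)^k}\pmod p$ for $m\not\equiv\pm64\pmod p$; $\sum_{n=0}^{p-1}\frac{V_n^{(6)}}{m^n}\equiv\big(\sum_{k=0}^{p-1}\frac{G_k^{(6)}}{m^k}\big)^2\equiv\sum_{k=0}^{p-1}\frac{\binom{2k}k\binom{3k}k\binom{6k}{3k}}{(864-m-186624/m)^k}\pmod p$ for $m\not\equiv\pm432\pmod p$.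
   Context: For real $x$ and integer $k\ge0$, $\binom xk=x(x-1)\cdots(x-k+1)/k!$. $G_n(x)=\sum_{k=0}^n\binom nk(-1)^k\binom xk\binom{ -1-x}k$, $V_n(x)=\sum_{k=0}^n\binom nk\binom{n+k}k(-1)^k\binom xk\binom{ -1-x}k$. $\mathbb Z_p$: rationals with denominator prime to $p$; congruences mod $p$ are in $\mathbb Z_p$. $G_n^{(r)}=c_r^nG_n(-1/r)$ and $V_n^{(r)}=c_r^nV_n(-1/r)$ for $(r,c_r)=(3,27),(4,64),(6,432)$. -}

module Defs where

open import Data.Nat as ℕ using (ℕ; zero; suc)
open import Data.Nat.Divisibility using (_∣_)
open import Data.Nat.Combinatorics using (_C_)
open import Data.Integer as ℤ using (ℤ; +_)
open import Data.Rational as ℚ using (ℚ; 0ℚ; 1ℚ; _+_; _*_; _-_; -_; 1/_; ≢-nonZero)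
open import Data.Rational.Properties using (_≟_)
open import Relation.Nullary using (yes; no; ¬_)
open import Data.Product using (_×_)

ι : ℕ → ℚ
ι n = (+ n) ℚ./ 1

_^_ : ℚ → ℕ → ℚ
q ^ zero  = 1ℚ
q ^ suc n = (q ^ n) * q

-- total reciprocal (0 ↦ 0); only ever applied to nonzero arguments below
inv : ℚ → ℚ
inv q with q ≟ 0ℚ
... | yes _  = 0ℚ
... | no q≢0 = 1/_ q {{≢-nonZero q≢0}}

binom : ℚ → ℕ → ℚ
binom x zero    = 1ℚ
binom x (suc k) = binom x k * (x - ι k) * ((+ 1) ℚ./ suc k)

Σ< : ℕ → (ℕ → ℚ) → ℚ
Σ< zero    f = 0ℚ
Σ< (suc n) f = Σ< n f + f n

Σ≤ : ℕ → (ℕ → ℚ) → ℚ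
Σ≤ n f = Σ< (suc n) f

InZp : ℕ → ℚ → Set
InZp p q = ¬ (p ∣ ℚ.denominatorℕ q)

-- a ≡ b (mod p) in ℤ_p, i.e. (a - b)/p ∈ ℤ_p.  For the reduced form n/d of a - b
-- this holds iff p ∣ n (then p ∤ d automatically since gcd(n,d) = 1).
_≡_[mod_] : ℚ → ℚ → ℕ → Set
a ≡ b [mod p ] = p ∣ ℤ.∣ ℚ.numerator (a - b) ∣

Chain : ℕ → ℚ → ℚ → ℚ → Set
Chain p a b c = (a ≡ b [mod p ]) × (b ≡ c [mod p ])

G : ℕ → ℚ → ℚ
G n x = Σ≤ n (λ k → ι (n C k) * ((- 1ℚ) ^ k) * binom x k * binom (- 1ℚ - x) k)

V : ℕ → ℚ → ℚ
V n x = Σ≤ n (λ k → ι (n C k) * ι ((n ℕ.+ k) C k) * ((- 1ℚ) ^ k) * binom x k * binom (- 1ℚ - x) k)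

Gr : ℕ → ℕ → ℕ → ℚ
Gr r c n = (ι c ^ n) * G n (- inv (ι r))

Vr : ℕ → ℕ → ℕ → ℚ
Vr r c n = (ι c ^ n) * V n (- inv (ι r))

{-# OPTIONS --safe #-}
-- Everything depends only on residues mod p, so replace x by a natural number a < p; then
-- C(x,k) C(-1-x,k) becomes (-1)^k c(a,k) with c(a,k) = C(a,k) C(a+k,k) (leg a k below). Put t = 1/m, w = 1/(1-t), y = t w,
-- so that 1 + y = w. Pascal's rule and Fermat's little theorem give Σ_{n<p} C(n,k) t^n ≡ y^k for k < p and
-- Σ_{n<p} C(n+k,2k) t^n ≡ (y w)^k for 2k < p. Since C(n,k) C(n+k,k) = C(2k,k) C(n+k,2k), and p divides
-- C(2k,k) when k < p ≤ 2k, the two sums become P_a(y) = Σ c(a,k) y^k and H_a(u) = Σ C(2k,k) c(a,k) u^k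
-- at u = y w = y (1 + y), where u = m/(m-1)² = -1/(2-m-1/m). What remains is Clausen's identity
-- P_a(y)² = H_a(y (1 + y)), proved over ℤ by induction on a from the three-term recurrence of P_a.
-- The three special cases replace m by m/c and rewrite c^k C(-1/r,k) C(1/r-1,k) as a product of binomial coefficients.
module Submission where

-- Passing to a natural residue `a < p` makes every series in k terminate below degree p. Cutting
-- the sums off at p then loses nothing, and Clausen's formula holds as an exact polynomial identity
-- over ℤ, with no error terms modulo p. P_a(y) is the Legendre polynomial at 1 + 2y, that is
-- 2F1(-a, a+1; 1; -y), and H_a(u) is 3F2(-a, a+1, 1/2; 1, 1; -4u). The classical proof compares
-- differential equations; here only contiguous relations between coefficients are used, multiplied
-- out so that no division occurs and no range of k has to be excluded. The square of the recurrence
-- of P_a produces products of neighbours and squares, and the matching objects on the other side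
-- are the sums of h(a,k) u^k with a weight linear in k. On the rational side a congruence is a
-- condition on a reduced numerator and reciprocals are total, neither of which is stable under
-- computation. All rationals are therefore handled through one relation, reduction of an arbitrary
-- fraction with denominator prime to p, and converted back only at the end.

module Clausen where

  open import Data.Nat as ℕ using (ℕ; zero; suc; z≤n; s≤s)
  import Data.Nat.Properties as ℕₚ
  open import Data.Nat.Combinatorics using (_C_; nCk+nC[k+1]≡[n+1]C[k+1]; nC1≡n; k>n⇒nCk≡0)
  open import Data.Integer using (ℤ; +_; 0ℤ; 1ℤ; _+_; _*_; _-_; -_; _^_)
  import Data.Integer.Properties as ℤₚ
  open import Data.Integer.Tactic.RingSolver using (solve-∀)
  open import Data.Product using (_×_; _,_; proj₁; proj₂)
  open import Relation.Binary.PropositionalEquality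
  open ≡-Reasoning

  -- Finite sums of integers.

  Σℤ : ℕ → (ℕ → ℤ) → ℤ
  Σℤ zero    f = 0ℤ
  Σℤ (suc n) f = Σℤ n f + f n

  Σℤ-cong : ∀ {f g} n → (∀ k → k ℕ.< n → f k ≡ g k) → Σℤ n f ≡ Σℤ n g
  Σℤ-cong zero    f≡g = refl
  Σℤ-cong (suc n) f≡g = cong₂ _+_ (Σℤ-cong n (λ k k<n → f≡g k (ℕₚ.m<n⇒m<1+n k<n))) (f≡g n (ℕₚ.n<1+n n))

  Σℤ-+ : ∀ n f g → Σℤ n (λ k → f k + g k) ≡ Σℤ n f + Σℤ n g
  Σℤ-+ zero    f g = refl
  Σℤ-+ (suc n) f g = trans (cong (_+ (f n + g n)) (Σℤ-+ n f g)) (interchange (Σℤ n f) (Σℤ n g) (f n) (g n))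
    where
    interchange : ∀ a b c d → a + b + (c + d) ≡ a + c + (b + d)
    interchange = solve-∀

  Σℤ-*ʳ : ∀ n f c → Σℤ n f * c ≡ Σℤ n (λ k → f k * c)
  Σℤ-*ʳ zero    f c = refl
  Σℤ-*ʳ (suc n) f c = trans (ℤₚ.*-distribʳ-+ c (Σℤ n f) (f n)) (cong (_+ f n * c) (Σℤ-*ʳ n f c))

  Σℤ-0 : ∀ n → Σℤ n (λ _ → 0ℤ) ≡ 0ℤ
  Σℤ-0 zero    = refl
  Σℤ-0 (suc n) = trans (ℤₚ.+-identityʳ _) (Σℤ-0 n)

  Σℤ-swap : ∀ m n (f : ℕ → ℕ → ℤ) → Σℤ m (λ i → Σℤ n (f i)) ≡ Σℤ n (λ j → Σℤ m (λ i → f i j))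
  Σℤ-swap zero    n f = sym (Σℤ-0 n)
  Σℤ-swap (suc m) n f = trans (cong (_+ Σℤ n (f m)) (Σℤ-swap m n f)) (sym (Σℤ-+ n (λ j → Σℤ m (λ i → f i j)) (f m)))

  Σℤ-extend : ∀ m j f → (∀ k → m ℕ.≤ k → f k ≡ 0ℤ) → Σℤ (j ℕ.+ m) f ≡ Σℤ m f
  Σℤ-extend m zero    f f≡0 = refl
  Σℤ-extend m (suc j) f f≡0 = trans (cong (λ z → Σℤ (j ℕ.+ m) f + z) (f≡0 (j ℕ.+ m) (ℕₚ.m≤n+m m j)))
                                    (trans (ℤₚ.+-identityʳ _) (Σℤ-extend m j f f≡0))

  Σℤ-extend-≤ : ∀ {m n} f → m ℕ.≤ n → (∀ k → m ℕ.≤ k → f k ≡ 0ℤ) → Σℤ n f ≡ Σℤ m f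
  Σℤ-extend-≤ {m} {n} f m≤n f≡0 = trans (cong (λ i → Σℤ i f) (sym (ℕₚ.m∸n+n≡m m≤n))) (Σℤ-extend m (n ℕ.∸ m) f f≡0)

  -- Integer binomial coefficients and their recurrences.

  bin : ℕ → ℕ → ℤ
  bin n k = + (n C k)

  pascal : ∀ n k → bin (suc n) (suc k) ≡ bin n k + bin n (suc k)
  pascal n k = cong +_ (sym (nCk+nC[k+1]≡[n+1]C[k+1] n k))

  bin-vanishes : ∀ {n k} → n ℕ.< k → bin n k ≡ 0ℤ
  bin-vanishes n<k = cong +_ (k>n⇒nCk≡0 n<k)

  -- The source of all coefficient recurrences below. Multiplied out, it needs neither division nor
  -- a bound on `k`, and follows from Pascal's rule by induction.
  absorption : ∀ n k → + suc k * bin (suc n) (suc k) ≡ + suc n * bin n k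
  absorption zero zero = refl
  absorption zero (suc k) = begin
    + suc (suc k) * bin 1 (suc (suc k)) ≡⟨ cong (+ suc (suc k) *_) (bin-vanishes {1} {suc (suc k)} (s≤s (s≤s z≤n))) ⟩
    + suc (suc k) * 0ℤ                  ≡⟨ ℤₚ.*-zeroʳ (+ suc (suc k)) ⟩
    0ℤ                                  ≡⟨ cong (1ℤ *_) (bin-vanishes {0} {suc k} (s≤s z≤n)) ⟨
    1ℤ * bin 0 (suc k)                  ∎
  absorption (suc n) zero = begin
    1ℤ * bin (suc (suc n)) 1 ≡⟨ ℤₚ.*-identityˡ _ ⟩
    bin (suc (suc n)) 1      ≡⟨ cong +_ (nC1≡n (suc (suc n))) ⟩
    + suc (suc n)            ≡⟨ ℤₚ.*-identityʳ (+ suc (suc n)) ⟨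
    + suc (suc n) * 1ℤ       ∎
  absorption (suc n) (suc k) = begin
    + suc (suc k) * bin (suc (suc n)) (suc (suc k))
      ≡⟨ cong (+ suc (suc k) *_) (pascal (suc n) (suc k)) ⟩
    + suc (suc k) * (bin (suc n) (suc k) + bin (suc n) (suc (suc k)))
      ≡⟨ split (+ suc k) (bin (suc n) (suc k)) (bin (suc n) (suc (suc k))) ⟩
    bin (suc n) (suc k) + (+ suc k * bin (suc n) (suc k) + + suc (suc k) * bin (suc n) (suc (suc k)))
      ≡⟨ cong (λ z → bin (suc n) (suc k) + z) (cong₂ _+_ (absorption n k) (absorption n (suc k))) ⟩
    bin (suc n) (suc k) + (+ suc n * bin n k + + suc n * bin n (suc k))
      ≡⟨ cong (λ z → bin (suc n) (suc k) + z) (ℤₚ.*-distribˡ-+ (+ suc n) (bin n k) (bin n (suc k))) ⟨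
    bin (suc n) (suc k) + + suc n * (bin n k + bin n (suc k))
      ≡⟨ cong (λ z → bin (suc n) (suc k) + + suc n * z) (pascal n k) ⟨
    bin (suc n) (suc k) + + suc n * bin (suc n) (suc k)
      ≡⟨ merge (+ suc n) (bin (suc n) (suc k)) ⟩
    + suc (suc n) * bin (suc n) (suc k) ∎
    where
    split : ∀ K X Y → (1ℤ + K) * (X + Y) ≡ X + (K * X + (1ℤ + K) * Y)
    split = solve-∀
    merge : ∀ N X → X + N * X ≡ (1ℤ + N) * X
    merge = solve-∀

  -- With n and k read as integers, the next two recurrences hold also for k > n.
  bin-step-k : ∀ n k → + suc k * bin n (suc k) ≡ (+ n - + k) * bin n k
  bin-step-k n k = begin
    + suc k * bin n (suc k)                                     ≡⟨ add (+ suc k) (bin n k) (bin n (suc k)) ⟩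
    + suc k * (bin n k + bin n (suc k)) - + suc k * bin n k     ≡⟨ cong (λ z → + suc k * z - + suc k * bin n k) (pascal n k) ⟨
    + suc k * bin (suc n) (suc k) - + suc k * bin n k           ≡⟨ cong (_- + suc k * bin n k) (absorption n k) ⟩
    + suc n * bin n k - + suc k * bin n k                       ≡⟨ merge (+ n) (+ k) (bin n k) ⟩
    (+ n - + k) * bin n k                                       ∎
    where
    add : ∀ K X Y → K * Y ≡ K * (X + Y) - K * X
    add = solve-∀
    merge : ∀ N K X → (1ℤ + N) * X - (1ℤ + K) * X ≡ (N - K) * X
    merge = solve-∀

  bin-step-n : ∀ n k → (+ suc n - + k) * bin (suc n) k ≡ + suc n * bin n k
  bin-step-n n k = trans (sym (bin-step-k (suc n) k)) (absorption n k)

  -- Contiguous relations of the Legendre coefficients and the central binomial coefficients.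

  leg : ℕ → ℕ → ℤ
  leg a k = bin a k * bin (a ℕ.+ k) k

  leg-vanishes : ∀ {a k} → a ℕ.< k → leg a k ≡ 0ℤ
  leg-vanishes {a} {k} a<k = cong (_* bin (a ℕ.+ k) k) (bin-vanishes a<k)

  leg-step-k : ∀ a k → + suc k * + suc k * leg a (suc k) ≡ (+ a - + k) * (+ a + + k + 1ℤ) * leg a k
  leg-step-k a k = begin
    + suc k * + suc k * (bin a (suc k) * bin (a ℕ.+ suc k) (suc k))
      ≡⟨ cong (λ n → + suc k * + suc k * (bin a (suc k) * bin n (suc k))) (ℕₚ.+-suc a k) ⟩
    + suc k * + suc k * (bin a (suc k) * bin (suc (a ℕ.+ k)) (suc k))
      ≡⟨ pair (+ suc k) (bin a (suc k)) (bin (suc (a ℕ.+ k)) (suc k)) ⟩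
    (+ suc k * bin a (suc k)) * (+ suc k * bin (suc (a ℕ.+ k)) (suc k))
      ≡⟨ cong₂ _*_ (bin-step-k a k) (absorption (a ℕ.+ k) k) ⟩
    ((+ a - + k) * bin a k) * (+ suc (a ℕ.+ k) * bin (a ℕ.+ k) k)
      ≡⟨ regroup (+ a) (+ k) (bin a k) (bin (a ℕ.+ k) k) ⟩
    (+ a - + k) * (+ a + + k + 1ℤ) * leg a k ∎
    where
    pair : ∀ K X Y → K * K * (X * Y) ≡ (K * X) * (K * Y)
    pair = solve-∀
    regroup : ∀ A K X Y → ((A - K) * X) * ((1ℤ + (A + K)) * Y) ≡ (A - K) * (A + K + 1ℤ) * (X * Y)
    regroup = solve-∀

  -- The cross-multiplied form survives `k = suc a`, where the factor on the left and `leg a k` on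
  -- the right both vanish.
  leg-step-a : ∀ a k → (+ suc a - + k) * leg (suc a) k ≡ (+ suc a + + k) * leg a k
  leg-step-a a k = begin
    (+ suc a - + k) * (bin (suc a) k * bin (suc (a ℕ.+ k)) k)  ≡⟨ ℤₚ.*-assoc (+ suc a - + k) _ _ ⟨
    (+ suc a - + k) * bin (suc a) k * bin (suc (a ℕ.+ k)) k    ≡⟨ cong (_* bin (suc (a ℕ.+ k)) k) (bin-step-n a k) ⟩
    + suc a * bin a k * bin (suc (a ℕ.+ k)) k                  ≡⟨ expand (+ a) (+ k) (bin a k) (bin (suc (a ℕ.+ k)) k) ⟩
    bin a k * ((+ suc (a ℕ.+ k) - + k) * bin (suc (a ℕ.+ k)) k) ≡⟨ cong (bin a k *_) (bin-step-n (a ℕ.+ k) k) ⟩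
    bin a k * (+ suc (a ℕ.+ k) * bin (a ℕ.+ k) k)              ≡⟨ regroup (+ a) (+ k) (bin a k) (bin (a ℕ.+ k) k) ⟩
    (+ suc a + + k) * leg a k                                  ∎
    where
    expand : ∀ A K X Y → (1ℤ + A) * X * Y ≡ X * ((1ℤ + (A + K) - K) * Y)
    expand = solve-∀
    regroup : ∀ A K X Y → X * ((1ℤ + (A + K)) * Y) ≡ (1ℤ + A + K) * (X * Y)
    regroup = solve-∀

  -- The recurrences in a compare coefficients of degree k+1 for three consecutive indices. This
  -- relation, `leg-step-k` and `leg-step-k↓` express all three through the single coefficient at
  -- the middle index and degree k, after which only a polynomial identity in a and k remains.
  leg-step-k↑ : ∀ a k → + suc k * + suc k * leg (suc a) (suc k) ≡ (+ a + + k + + 2) * (+ a + + k + 1ℤ) * leg a k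
  leg-step-k↑ a k = begin
    + suc k * + suc k * leg (suc a) (suc k)                       ≡⟨ leg-step-k (suc a) k ⟩
    (+ suc a - + k) * (+ suc a + + k + 1ℤ) * leg (suc a) k        ≡⟨ swap (+ a) (+ k) _ ⟩
    (+ a + + k + + 2) * ((+ suc a - + k) * leg (suc a) k)         ≡⟨ cong ((+ a + + k + + 2) *_) (leg-step-a a k) ⟩
    (+ a + + k + + 2) * ((+ suc a + + k) * leg a k)               ≡⟨ regroup (+ a) (+ k) _ ⟩
    (+ a + + k + + 2) * (+ a + + k + 1ℤ) * leg a k                ∎
    where
    swap : ∀ A K X → (1ℤ + A - K) * (1ℤ + A + K + 1ℤ) * X ≡ (A + K + + 2) * ((1ℤ + A - K) * X)
    swap = solve-∀
    regroup : ∀ A K X → (A + K + + 2) * ((1ℤ + A + K) * X) ≡ (A + K + + 2) * (A + K + 1ℤ) * X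
    regroup = solve-∀

  leg-step-k↓ : ∀ a k → + suc k * + suc k * leg a (suc k) ≡ (+ a - + k) * (+ suc a - + k) * leg (suc a) k
  leg-step-k↓ a k = begin
    + suc k * + suc k * leg a (suc k)                     ≡⟨ leg-step-k a k ⟩
    (+ a - + k) * (+ a + + k + 1ℤ) * leg a k              ≡⟨ regroup (+ a) (+ k) _ ⟩
    (+ a - + k) * ((+ suc a + + k) * leg a k)             ≡⟨ cong ((+ a - + k) *_) (leg-step-a a k) ⟨
    (+ a - + k) * ((+ suc a - + k) * leg (suc a) k)       ≡⟨ ℤₚ.*-assoc (+ a - + k) _ _ ⟨
    (+ a - + k) * (+ suc a - + k) * leg (suc a) k         ∎
    where
    regroup : ∀ A K X → (A - K) * (A + K + 1ℤ) * X ≡ (A - K) * ((1ℤ + A + K) * X)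
    regroup = solve-∀

  central : ℕ → ℤ
  central k = bin (2 ℕ.* k) k

  central-step : ∀ k → + suc k * central (suc k) ≡ + 2 * (+ 2 * + k + 1ℤ) * central k
  central-step k = begin
    + suc k * bin (2 ℕ.* suc k) (suc k)
      ≡⟨ cong (λ n → + suc k * bin n (suc k)) (ℕₚ.*-suc 2 k) ⟩
    + suc k * bin (suc (suc (2 ℕ.* k))) (suc k)
      ≡⟨ absorption (suc (2 ℕ.* k)) k ⟩
    + suc (suc (2 ℕ.* k)) * bin (suc (2 ℕ.* k)) k
      ≡⟨ cong (λ z → (1ℤ + (1ℤ + z)) * bin (suc (2 ℕ.* k)) k) 2k ⟩
    (1ℤ + (1ℤ + + 2 * + k)) * bin (suc (2 ℕ.* k)) k
      ≡⟨ expand (+ k) _ ⟩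
    + 2 * ((1ℤ + + 2 * + k - + k) * bin (suc (2 ℕ.* k)) k)
      ≡⟨ cong (λ z → + 2 * ((1ℤ + z - + k) * bin (suc (2 ℕ.* k)) k)) 2k ⟨
    + 2 * ((+ suc (2 ℕ.* k) - + k) * bin (suc (2 ℕ.* k)) k)
      ≡⟨ cong (+ 2 *_) (bin-step-n (2 ℕ.* k) k) ⟩
    + 2 * (+ suc (2 ℕ.* k) * central k)
      ≡⟨ cong (λ z → + 2 * ((1ℤ + z) * central k)) 2k ⟩
    + 2 * ((1ℤ + + 2 * + k) * central k)
      ≡⟨ regroup (+ k) _ ⟩
    + 2 * (+ 2 * + k + 1ℤ) * central k ∎
    where
    2k : + (2 ℕ.* k) ≡ + 2 * + k
    2k = ℤₚ.pos-* 2 k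
    expand : ∀ K X → (1ℤ + (1ℤ + + 2 * K)) * X ≡ + 2 * ((1ℤ + + 2 * K - K) * X)
    expand = solve-∀
    regroup : ∀ K X → + 2 * ((1ℤ + + 2 * K) * X) ≡ + 2 * (+ 2 * K + 1ℤ) * X
    regroup = solve-∀

  -- Truncated polynomials given by coefficient sequences.

  poly : ℕ → (ℕ → ℤ) → ℤ → ℤ
  poly N d y = Σℤ N (λ k → d k * y ^ k)

  poly-cong : ∀ {d e} N y → (∀ k → d k ≡ e k) → poly N d y ≡ poly N e y
  poly-cong zero    y d≡e = refl
  poly-cong (suc N) y d≡e = cong₂ _+_ (poly-cong N y d≡e) (cong (_* y ^ N) (d≡e N))

  poly-scale : ∀ N α d y → poly N (λ k → α * d k) y ≡ α * poly N d y
  poly-scale zero    α d y = sym (ℤₚ.*-zeroʳ α)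
  poly-scale (suc N) α d y = trans (cong (_+ α * d N * y ^ N) (poly-scale N α d y)) (step α (poly N d y) (d N) (y ^ N))
    where
    step : ∀ α S D Y → α * S + α * D * Y ≡ α * (S + D * Y)
    step = solve-∀

  poly-sub : ∀ N d e y → poly N (λ k → d k - e k) y ≡ poly N d y - poly N e y
  poly-sub zero    d e y = refl
  poly-sub (suc N) d e y = trans (cong (_+ (d N - e N) * y ^ N) (poly-sub N d e y)) (step (poly N d y) (poly N e y) (d N) (e N) (y ^ N))
    where
    step : ∀ S T D E Y → S - T + (D - E) * Y ≡ S + D * Y - (T + E * Y)
    step = solve-∀

  poly-shift : ∀ M d e y → d 0 ≡ 0ℤ → (∀ k → d (suc k) ≡ e k) → poly (suc M) d y ≡ y * poly M e y
  poly-shift zero    d e y d₀ ds = trans (cong (λ z → 0ℤ + z * 1ℤ) d₀) (sym (ℤₚ.*-zeroʳ y))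
  poly-shift (suc M) d e y d₀ ds = begin
    poly (suc M) d y + d (suc M) * (y * y ^ M)   ≡⟨ cong₂ (λ s c → s + c * (y * y ^ M)) (poly-shift M d e y d₀ ds) (ds M) ⟩
    y * poly M e y + e M * (y * y ^ M)           ≡⟨ step y (poly M e y) (e M) (y ^ M) ⟩
    y * (poly M e y + e M * y ^ M)               ∎
    where
    step : ∀ y S E Y → y * S + E * (y * Y) ≡ y * (S + E * Y)
    step = solve-∀

  -- A product with y would raise the length by one. The vanishing top coefficient of `e` absorbs
  -- this, so that recurrences can be stated with one length on both sides.
  poly-shift′ : ∀ M d e y → d 0 ≡ 0ℤ → (∀ k → d (suc k) ≡ e k) → e M ≡ 0ℤ →
                poly (suc M) d y ≡ y * poly (suc M) e y
  poly-shift′ M d e y d₀ ds eM = trans (poly-shift M d e y d₀ ds) (cong (y *_) (sym last))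
    where
    last : poly M e y + e M * y ^ M ≡ poly M e y
    last = trans (cong (λ z → poly M e y + z * y ^ M) eM) (ℤₚ.+-identityʳ _)

  -- Recurrences in a for the Legendre polynomials and for their squares.

  P : ℕ → ℕ → ℤ → ℤ
  P N a y = poly N (leg a) y

  h : ℕ → ℕ → ℤ
  h a k = central k * leg a k

  H : ℕ → ℕ → ℤ → ℤ
  H N a u = poly N (h a) u

  cancel : ∀ k {x y} → + suc k * x ≡ + suc k * y → x ≡ y
  cancel k = ℤₚ.*-cancelˡ-≡ (+ suc k) _ _

  -- Bonnet's recurrence at the argument 1 + 2y. The terms free of the factor 2y are collected into
  -- `d`; its constant coefficient vanishes and its later coefficients are those of the 2y term,
  -- shifted by one degree.
  P-recurrence : ∀ M a y → suc a ℕ.< M →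
    + suc (suc a) * P (suc M) (suc (suc a)) y
      ≡ (+ 2 * + a + + 3) * (1ℤ + + 2 * y) * P (suc M) (suc a) y - + suc a * P (suc M) a y
  P-recurrence M a y a<M = solveFor (+ suc (suc a) * Q (suc (suc a))) D (Q (suc a)) (+ suc a * Q a) y (begin
    + suc (suc a) * Q (suc (suc a)) - (D * Q (suc a) - + suc a * Q a)
      ≡⟨ cong₂ _-_ (poly-scale N (+ suc (suc a)) (leg (suc (suc a))) y)
           (trans (poly-sub N (λ k → D * leg (suc a) k) (λ k → + suc a * leg a k) y)
                  (cong₂ _-_ (poly-scale N D (leg (suc a)) y) (poly-scale N (+ suc a) (leg a) y))) ⟨
    poly N (λ k → + suc (suc a) * leg (suc (suc a)) k) y - poly N (λ k → D * leg (suc a) k - + suc a * leg a k) y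
      ≡⟨ poly-sub N (λ k → + suc (suc a) * leg (suc (suc a)) k) (λ k → D * leg (suc a) k - + suc a * leg a k) y ⟨
    poly N d y
      ≡⟨ poly-shift′ M d e y (base (+ a)) step (trans (cong (+ 2 * D *_) (leg-vanishes a<M)) (ℤₚ.*-zeroʳ (+ 2 * D))) ⟩
    y * poly N e y
      ≡⟨ cong (y *_) (poly-scale N (+ 2 * D) (leg (suc a)) y) ⟩
    y * (+ 2 * D * Q (suc a)) ∎)
    where
    N = suc M
    D = + 2 * + a + + 3
    Q : ℕ → ℤ
    Q a = P N a y
    d e : ℕ → ℤ
    d k = + suc (suc a) * leg (suc (suc a)) k - (D * leg (suc a) k - + suc a * leg a k)
    e k = + 2 * D * leg (suc a) k
    base : ∀ A → (+ 2 + A) * 1ℤ - ((+ 2 * A + + 3) * 1ℤ - (1ℤ + A) * 1ℤ) ≡ 0ℤ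
    base = solve-∀
    solveFor : ∀ X D R Z y → X - (D * R - Z) ≡ y * (+ 2 * D * R) → X ≡ D * (1ℤ + + 2 * y) * R - Z
    solveFor X D R Z y eq = trans (l X (D * R - Z)) (trans (cong (_+ (D * R - Z)) eq) (r D R Z y))
      where
      l : ∀ X Y → X ≡ X - Y + Y
      l = solve-∀
      r : ∀ D R Z y → y * (+ 2 * D * R) + (D * R - Z) ≡ D * (1ℤ + + 2 * y) * R - Z
      r = solve-∀
    distribute : ∀ A K u v w →
      (1ℤ + K) * ((1ℤ + K) * ((+ 2 + A) * u - ((+ 2 * A + + 3) * v - (1ℤ + A) * w)))
        ≡ (+ 2 + A) * ((1ℤ + K) * (1ℤ + K) * u)
          - ((+ 2 * A + + 3) * ((1ℤ + K) * (1ℤ + K) * v) - (1ℤ + A) * ((1ℤ + K) * (1ℤ + K) * w))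
    distribute = solve-∀
    collect : ∀ A K X →
      (+ 2 + A) * ((1ℤ + A + K + + 2) * (1ℤ + A + K + 1ℤ) * X)
        - ((+ 2 * A + + 3) * ((1ℤ + A - K) * (1ℤ + A + K + 1ℤ) * X) - (1ℤ + A) * ((A - K) * (1ℤ + A - K) * X))
        ≡ (1ℤ + K) * ((1ℤ + K) * (+ 2 * (+ 2 * A + + 3) * X))
    collect = solve-∀
    step : ∀ k → d (suc k) ≡ e k
    step k = cancel k (cancel k (begin
      + suc k * (+ suc k * d (suc k))
        ≡⟨ distribute (+ a) (+ k) (leg (suc (suc a)) (suc k)) (leg (suc a) (suc k)) (leg a (suc k)) ⟩
      + suc (suc a) * (+ suc k * + suc k * leg (suc (suc a)) (suc k))
        - (D * (+ suc k * + suc k * leg (suc a) (suc k)) - + suc a * (+ suc k * + suc k * leg a (suc k)))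
        ≡⟨ cong₂ (λ s t → + suc (suc a) * s - t) (leg-step-k↑ (suc a) k)
             (cong₂ (λ s t → D * s - + suc a * t) (leg-step-k (suc a) k) (leg-step-k↓ a k)) ⟩
      _ ≡⟨ collect (+ a) (+ k) (leg (suc a) k) ⟩
      + suc k * (+ suc k * e k) ∎))

  -- The counterpart of Bonnet's recurrence for the squares. The weight `2k+1` is the operator 1 +
  -- 2u d/du applied to H at the middle index; it arises from the ratio 2(2k+1)/(k+1) of central
  -- binomial coefficients, and `odd-weighted` trades it for `cross`.
  H-recurrence : ∀ M a u → suc a ℕ.< M →
    + suc (suc a) * + suc (suc a) * H (suc M) (suc (suc a)) u
      ≡ (+ 2 * + a + + 3) * (1ℤ + + 4 * u) * poly (suc M) (λ k → (+ 2 * + k + 1ℤ) * h (suc a) k) u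
        + + suc a * + suc a * H (suc M) a u
  H-recurrence M a u a<M = solveFor (E * H N (suc (suc a)) u) D B F (H N a u) (begin
    E * H N (suc (suc a)) u - (D * B - - F * H N a u)
      ≡⟨ cong₂ _-_ (poly-scale N E (h (suc (suc a))) u)
           (trans (poly-sub N (λ k → D * b k) (λ k → - F * h a k) u)
                  (cong₂ _-_ (poly-scale N D b u) (poly-scale N (- F) (h a) u))) ⟨
    poly N (λ k → E * h (suc (suc a)) k) u - poly N (λ k → D * b k - - F * h a k) u
      ≡⟨ poly-sub N (λ k → E * h (suc (suc a)) k) (λ k → D * b k - - F * h a k) u ⟨
    poly N d u
      ≡⟨ poly-shift′ M d e u (base (+ a)) step eM ⟩
    u * poly N e u
      ≡⟨ cong (u *_) (poly-scale N (+ 4 * D) b u) ⟩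
    u * (+ 4 * D * B) ∎)
    where
    N = suc M
    D = + 2 * + a + + 3
    E = + suc (suc a) * + suc (suc a)
    F = + suc a * + suc a
    b d e : ℕ → ℤ
    b k = (+ 2 * + k + 1ℤ) * h (suc a) k
    -- The last term enters with the sign opposite to that in `P-recurrence`; written as the
    -- subtraction of `- F`, it still fits `poly-sub`.
    d k = E * h (suc (suc a)) k - (D * b k - - F * h a k)
    e k = + 4 * D * b k
    B = poly N b u
    eM : e M ≡ 0ℤ
    eM = trans (cong (λ z → + 4 * D * ((+ 2 * + M + 1ℤ) * (central M * z))) (leg-vanishes a<M)) (z (+ 4 * D) (+ 2 * + M + 1ℤ) (central M))
      where
      z : ∀ X Y Z → X * (Y * (Z * 0ℤ)) ≡ 0ℤ
      z = solve-∀
    base : ∀ A → (+ 2 + A) * (+ 2 + A) * 1ℤ - ((+ 2 * A + + 3) * 1ℤ - - ((1ℤ + A) * (1ℤ + A)) * 1ℤ) ≡ 0ℤ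
    base = solve-∀
    solveFor : ∀ X D R F Z → X - (D * R - - F * Z) ≡ u * (+ 4 * D * R) → X ≡ D * (1ℤ + + 4 * u) * R + F * Z
    solveFor X D R F Z eq = trans (l X (D * R - - F * Z)) (trans (cong (_+ (D * R - - F * Z)) eq) (r D R F Z u))
      where
      l : ∀ X Y → X ≡ X - Y + Y
      l = solve-∀
      r : ∀ D R F Z u → u * (+ 4 * D * R) + (D * R - - F * Z) ≡ D * (1ℤ + + 4 * u) * R + F * Z
      r = solve-∀
    distribute : ∀ E D F K c u v w →
      (1ℤ + K) * ((1ℤ + K) * ((1ℤ + K) * (E * (c * u) - (D * ((+ 2 * (1ℤ + K) + 1ℤ) * (c * v)) - - F * (c * w)))))
        ≡ ((1ℤ + K) * c) * (E * ((1ℤ + K) * (1ℤ + K) * u)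
          - (D * ((+ 2 * K + + 3) * ((1ℤ + K) * (1ℤ + K) * v)) - - F * ((1ℤ + K) * (1ℤ + K) * w)))
    distribute = solve-∀
    collect : ∀ A K c X →
      (+ 2 * (+ 2 * K + 1ℤ) * c) * ((+ 2 + A) * (+ 2 + A) * ((1ℤ + A + K + + 2) * (1ℤ + A + K + 1ℤ) * X)
        - ((+ 2 * A + + 3) * ((+ 2 * K + + 3) * ((1ℤ + A - K) * (1ℤ + A + K + 1ℤ) * X))
           - - ((1ℤ + A) * (1ℤ + A)) * ((A - K) * (1ℤ + A - K) * X)))
        ≡ (1ℤ + K) * ((1ℤ + K) * ((1ℤ + K) * (+ 4 * (+ 2 * A + + 3) * ((+ 2 * K + 1ℤ) * (c * X)))))
    collect = solve-∀
    step : ∀ k → d (suc k) ≡ e k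
    -- Two factors `suc k` lower the Legendre coefficients, the third lowers `central (suc k)`.
    step k = cancel k (cancel k (cancel k (begin
      + suc k * (+ suc k * (+ suc k * d (suc k)))
        ≡⟨ distribute E D F (+ k) (central (suc k)) (leg (suc (suc a)) (suc k)) (leg (suc a) (suc k)) (leg a (suc k)) ⟩
      (+ suc k * central (suc k)) * (E * (+ suc k * + suc k * leg (suc (suc a)) (suc k))
        - (D * ((+ 2 * + k + + 3) * (+ suc k * + suc k * leg (suc a) (suc k))) - - F * (+ suc k * + suc k * leg a (suc k))))
        ≡⟨ cong₂ _*_ (central-step k) (cong₂ (λ s t → E * s - t) (leg-step-k↑ (suc a) k)
             (cong₂ (λ s t → D * ((+ 2 * + k + + 3) * s) - - F * t) (leg-step-k (suc a) k) (leg-step-k↓ a k))) ⟩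
      _ ≡⟨ collect (+ a) (+ k) (central k) (leg (suc a) k) ⟩
      + suc k * (+ suc k * (+ suc k * e k)) ∎)))

  -- Clausen's identity by induction on a.

  h-vanishes : ∀ {a k} → a ℕ.< k → h a k ≡ 0ℤ
  h-vanishes {a} {k} a<k = trans (cong (central k *_) (leg-vanishes a<k)) (ℤₚ.*-zeroʳ (central k))

  -- The even part of the mixed product: (a+1) P_{a+1} P_a is 1 + 2y times this sum. The weight
  -- a+1+k is the one that appears in `leg-step-a`, so the sum can be rewritten over either of the
  -- two indices.
  cross : ℕ → ℕ → ℤ → ℤ
  cross N a u = poly N (λ k → (+ suc a + + k) * h a k) u

  h-step-a : ∀ a k → (+ suc a - + k) * h (suc a) k ≡ (+ suc a + + k) * h a k
  h-step-a a k = trans (swap (+ suc a - + k) (central k) (leg (suc a) k))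
    (trans (cong (central k *_) (leg-step-a a k)) (sym (swap (+ suc a + + k) (central k) (leg a k))))
    where
    swap : ∀ x y z → x * (y * z) ≡ y * (x * z)
    swap = solve-∀

  -- The weight splits as a+2+k = (2a+3) - (a+1-k), and `h-step-a` carries the second part down to
  -- index a.
  cross-step : ∀ N a u → cross N (suc a) u ≡ (+ 2 * + a + + 3) * H N (suc a) u - cross N a u
  cross-step N a u = begin
    cross N (suc a) u
      ≡⟨ poly-cong N u (λ k → trans (expand (+ a) (+ k) (h (suc a) k))
                              (cong (λ z → (+ 2 * + a + + 3) * h (suc a) k - z) (h-step-a a k))) ⟩
    poly N (λ k → (+ 2 * + a + + 3) * h (suc a) k - (+ suc a + + k) * h a k) u
      ≡⟨ poly-sub N (λ k → (+ 2 * + a + + 3) * h (suc a) k) (λ k → (+ suc a + + k) * h a k) u ⟩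
    poly N (λ k → (+ 2 * + a + + 3) * h (suc a) k) u - cross N a u
      ≡⟨ cong (_- cross N a u) (poly-scale N (+ 2 * + a + + 3) (h (suc a)) u) ⟩
    (+ 2 * + a + + 3) * H N (suc a) u - cross N a u ∎
    where
    expand : ∀ A K X → (1ℤ + (1ℤ + A) + K) * X ≡ (+ 2 * A + + 3) * X - (1ℤ + A - K) * X
    expand = solve-∀

  -- The same device with 2k+1 = (2a+3) - 2(a+1-k). It brings the weighted sum of `H-recurrence`
  -- into the quantities that the induction controls.
  odd-weighted : ∀ N a u → poly N (λ k → (+ 2 * + k + 1ℤ) * h (suc a) k) u
                            ≡ (+ 2 * + a + + 3) * H N (suc a) u - + 2 * cross N a u
  odd-weighted N a u = begin
    poly N (λ k → (+ 2 * + k + 1ℤ) * h (suc a) k) u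
      ≡⟨ poly-cong N u (λ k → trans (expand (+ a) (+ k) (h (suc a) k))
                              (cong (λ z → (+ 2 * + a + + 3) * h (suc a) k - + 2 * z) (h-step-a a k))) ⟩
    poly N (λ k → (+ 2 * + a + + 3) * h (suc a) k - + 2 * ((+ suc a + + k) * h a k)) u
      ≡⟨ poly-sub N (λ k → (+ 2 * + a + + 3) * h (suc a) k) (λ k → + 2 * ((+ suc a + + k) * h a k)) u ⟩
    poly N (λ k → (+ 2 * + a + + 3) * h (suc a) k) u - poly N (λ k → + 2 * ((+ suc a + + k) * h a k)) u
      ≡⟨ cong₂ _-_ (poly-scale N (+ 2 * + a + + 3) (h (suc a)) u) (poly-scale N (+ 2) (λ k → (+ suc a + + k) * h a k) u) ⟩
    (+ 2 * + a + + 3) * H N (suc a) u - + 2 * cross N a u ∎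
    where
    expand : ∀ A K X → (+ 2 * K + 1ℤ) * X ≡ (+ 2 * A + + 3) * X - + 2 * ((1ℤ + A - K) * X)
    expand = solve-∀

  -- Squares alone do not determine the square of the next term: the mixed product P_{a+1} P_a, which is
  -- 1 + 2y times a polynomial in y (1 + y), closes the induction.
  clausen-invariant : ∀ M a y → a ℕ.< M →
    let N = suc M ; u = y * (1ℤ + y) in
      (P N a y * P N a y ≡ H N a u)
    × (P N (suc a) y * P N (suc a) y ≡ H N (suc a) u)
    × (+ suc a * (P N (suc a) y * P N a y) ≡ (1ℤ + + 2 * y) * cross N a u)
  -- At a = 0 the values are P_0 = H_0 = 1, `cross` = 1, P_1 = 1 + 2y and H_1 = 1 + 4u, and (1 +
  -- 2y)² = 1 + 4y(1 + y). The length is at least two, so P_1 and H_1 are complete.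
  clausen-invariant (suc M) zero y _ =
    trans (cong₂ _*_ P₀ P₀) (sym H₀) , trans (cong₂ _*_ P₁ P₁) (trans (square y) (sym H₁)) ,
    trans (cong (1ℤ *_) (cong₂ _*_ P₁ P₀)) (trans (base y) (cong ((1ℤ + + 2 * y) *_) (sym X₀)))
    where
    u = y * (1ℤ + y)
    first : ∀ d z → (∀ k → 0 ℕ.< k → d k ≡ 0ℤ) → poly (suc (suc M)) d z ≡ d 0 + 0ℤ
    first d z v = trans (cong (λ n → poly n d z) (ℕₚ.+-comm 1 (suc M)))
      (trans (Σℤ-extend 1 (suc M) (λ k → d k * z ^ k) (λ k 0<k → cong (_* z ^ k) (v k 0<k))) (one (d 0)))
      where
      one : ∀ x → 0ℤ + x * 1ℤ ≡ x + 0ℤ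
      one = solve-∀
    firstTwo : ∀ d z → (∀ k → 1 ℕ.< k → d k ≡ 0ℤ) → poly (suc (suc M)) d z ≡ d 0 + d 1 * z
    firstTwo d z v = trans (cong (λ n → poly n d z) (ℕₚ.+-comm 2 M))
      (trans (Σℤ-extend 2 M (λ k → d k * z ^ k) (λ k 1<k → cong (_* z ^ k) (v k 1<k))) (two (d 0) (d 1) z))
      where
      two : ∀ x y z → 0ℤ + x * 1ℤ + y * (z * 1ℤ) ≡ x + y * z
      two = solve-∀
    P₀ : P (suc (suc M)) 0 y ≡ 1ℤ
    P₀ = first (leg 0) y (λ k → leg-vanishes)
    H₀ : H (suc (suc M)) 0 u ≡ 1ℤ
    H₀ = first (h 0) u (λ k → h-vanishes)
    X₀ : cross (suc (suc M)) 0 u ≡ 1ℤ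
    X₀ = first (λ k → (1ℤ + + k) * h 0 k) u (λ k 0<k → trans (cong ((1ℤ + + k) *_) (h-vanishes 0<k)) (ℤₚ.*-zeroʳ (1ℤ + + k)))
    P₁ : P (suc (suc M)) 1 y ≡ 1ℤ + + 2 * y
    P₁ = firstTwo (leg 1) y (λ k → leg-vanishes)
    H₁ : H (suc (suc M)) 1 u ≡ 1ℤ + + 4 * u
    H₁ = firstTwo (h 1) u (λ k → h-vanishes)
    square : ∀ y → (1ℤ + + 2 * y) * (1ℤ + + 2 * y) ≡ 1ℤ + + 4 * (y * (1ℤ + y))
    square = solve-∀
    base : ∀ y → 1ℤ * ((1ℤ + + 2 * y) * 1ℤ) ≡ (1ℤ + + 2 * y) * 1ℤ
    base = solve-∀
  clausen-invariant M (suc a) y a<M with clausen-invariant M a y (ℕₚ.<-trans (ℕₚ.n<1+n a) a<M)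
  ... | sq₀ , sq₁ , mixed = sq₁ , cancel (suc a) (cancel (suc a) sq₂) , mixed′
    where
    N = suc M
    u = y * (1ℤ + y)
    D = + 2 * + a + + 3
    e₁ = + suc a
    e₂ = + suc (suc a)
    p₀ = P N a y
    p₁ = P N (suc a) y
    p₂ = P N (suc (suc a)) y
    z = 1ℤ + + 2 * y
    rec : e₂ * p₂ ≡ D * z * p₁ - e₁ * p₀
    rec = P-recurrence M a y a<M
    mixed′ : e₂ * (p₂ * p₁) ≡ z * cross N (suc a) u
    mixed′ = begin
      e₂ * (p₂ * p₁)                             ≡⟨ ℤₚ.*-assoc e₂ p₂ p₁ ⟨
      e₂ * p₂ * p₁                               ≡⟨ cong (_* p₁) rec ⟩
      (D * z * p₁ - e₁ * p₀) * p₁                ≡⟨ expand D z p₁ e₁ p₀ ⟩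
      D * z * (p₁ * p₁) - e₁ * (p₁ * p₀)         ≡⟨ cong₂ (λ s t → D * z * s - t) sq₁ mixed ⟩
      D * z * H N (suc a) u - z * cross N a u    ≡⟨ collect D z (H N (suc a) u) (cross N a u) ⟩
      z * (D * H N (suc a) u - cross N a u)      ≡⟨ cong (z *_) (cross-step N a u) ⟨
      z * cross N (suc a) u                      ∎
      where
      expand : ∀ D z p₁ e p₀ → (D * z * p₁ - e * p₀) * p₁ ≡ D * z * (p₁ * p₁) - e * (p₁ * p₀)
      expand = solve-∀
      collect : ∀ D z s t → D * z * s - z * t ≡ z * (D * s - t)
      collect = solve-∀
    -- Squaring Bonnet's recurrence leaves p₁², p₁p₀ and p₀², all known by induction. The odd factor
    -- z from the mixed product meets another z, and z² = 1 + 4u makes the result a function of u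
    -- alone.
    sq₂ : e₂ * (e₂ * (p₂ * p₂)) ≡ e₂ * (e₂ * H N (suc (suc a)) u)
    sq₂ = begin
      e₂ * (e₂ * (p₂ * p₂))                              ≡⟨ pair e₂ p₂ ⟩
      (e₂ * p₂) * (e₂ * p₂)                              ≡⟨ cong (λ s → s * s) rec ⟩
      (D * z * p₁ - e₁ * p₀) * (D * z * p₁ - e₁ * p₀)    ≡⟨ expand D z p₁ e₁ p₀ ⟩
      D * z * (D * z * (p₁ * p₁)) - + 2 * D * z * (e₁ * (p₁ * p₀)) + e₁ * e₁ * (p₀ * p₀)
        ≡⟨ cong₂ _+_ (cong₂ (λ s t → D * z * (D * z * s) - + 2 * D * z * t) sq₁ mixed) (cong (e₁ * e₁ *_) sq₀) ⟩
      D * z * (D * z * H N (suc a) u) - + 2 * D * z * (z * cross N a u) + e₁ * e₁ * H N a u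
        ≡⟨ collect D y (H N (suc a) u) (cross N a u) (e₁ * e₁ * H N a u) ⟩
      D * (1ℤ + + 4 * u) * (D * H N (suc a) u - + 2 * cross N a u) + e₁ * e₁ * H N a u
        ≡⟨ cong (λ s → D * (1ℤ + + 4 * u) * s + e₁ * e₁ * H N a u) (odd-weighted N a u) ⟨
      D * (1ℤ + + 4 * u) * poly N (λ k → (+ 2 * + k + 1ℤ) * h (suc a) k) u + e₁ * e₁ * H N a u
        ≡⟨ H-recurrence M a u a<M ⟨
      e₂ * e₂ * H N (suc (suc a)) u                      ≡⟨ ℤₚ.*-assoc e₂ e₂ (H N (suc (suc a)) u) ⟩
      e₂ * (e₂ * H N (suc (suc a)) u)                    ∎
      where
      pair : ∀ e p → e * (e * (p * p)) ≡ (e * p) * (e * p)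
      pair = solve-∀
      expand : ∀ D z p₁ e p₀ → (D * z * p₁ - e * p₀) * (D * z * p₁ - e * p₀)
               ≡ D * z * (D * z * (p₁ * p₁)) - + 2 * D * z * (e * (p₁ * p₀)) + e * e * (p₀ * p₀)
      expand = solve-∀
      collect : ∀ D y s t r → D * (1ℤ + + 2 * y) * (D * (1ℤ + + 2 * y) * s) - + 2 * D * (1ℤ + + 2 * y) * ((1ℤ + + 2 * y) * t) + r
               ≡ D * (1ℤ + + 4 * (y * (1ℤ + y))) * (D * s - + 2 * t) + r
      collect = solve-∀

  -- The invariant at a also speaks of a+1 and so needs a+1 < N. For positive a the square is read
  -- off the invariant at a-1, which admits a = N-1; this is needed for the residue a = p-1.
  clausen : ∀ N a y → a ℕ.< N → 1 ℕ.< N → P N a y * P N a y ≡ H N a (y * (1ℤ + y))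
  clausen (suc M) zero    y _         (s≤s 0<M) = proj₁ (clausen-invariant M 0 y 0<M)
  clausen (suc M) (suc a) y (s≤s a<M) _         = proj₁ (proj₂ (clausen-invariant M a y a<M))

module Residues where

  open Clausen
  open import Data.Nat as ℕ using (ℕ; zero; suc; z≤n; s≤s; _!)
  import Data.Nat.Properties as ℕₚ
  import Data.Nat.Divisibility as ℕ∣
  import Data.Nat.DivMod as ℕ/
  open import Data.Nat.Primality using (Prime; euclidsLemma; prime⇒nonZero; prime⇒nonTrivial)
  open import Data.Nat.Coprimality using (coprime-Bézout; prime⇒coprime)
  open import Data.Nat.GCD using (module Bézout)
  open import Data.Nat.Combinatorics
    using (_C_; nCn≡1; nCk≡n!/k![n-k]!; k![n∸k]!∣n!)
  open import Data.Integer using (ℤ; +_; 0ℤ; 1ℤ; _+_; _*_; _-_; -_; _^_; ∣_∣)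
  import Data.Integer.Properties as ℤₚ
  open import Data.Integer.DivMod using (_%ℕ_; _/ℕ_; a≡a%ℕn+[a/ℕn]*n; n%ℕd<d)
  import Data.Integer.Divisibility.Signed as ℤ∣
  open import Data.Integer.Tactic.RingSolver using (solve-∀)
  open import Data.Rational as ℚ using (ℚ; mkℚ; 0ℚ; 1ℚ; ↥_; ↧_; toℚᵘ)
  import Data.Rational.Properties as ℚₚ
  open import Data.Rational.Unnormalised using (mkℚᵘ; *≡*)
  import Data.Rational.Unnormalised.Base as ℚᵘ
  import Data.Rational.Unnormalised.Properties as ℚᵘₚ
  open import Data.Rational.Solver using (module +-*-Solver)
  open import Data.Product using (_×_; _,_; proj₁; proj₂; ∃)
  open import Data.Sum using (inj₁; inj₂)
  open import Data.Empty using (⊥-elim)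
  open import Relation.Nullary using (¬_; Dec; yes; no)
  open import Relation.Nullary.Decidable using (map′)
  open import Relation.Binary.PropositionalEquality
  open import Relation.Binary.Bundles using (Setoid)
  import Relation.Binary.Reasoning.Setoid as SetoidReasoning
  import Defs as D

  -- The binomial theorem, factorial formulas and the coefficients of V.

  -- By Pascal's rule, consecutive rows differ by the earlier row shifted one degree, that is,
  -- multiplied by t.
  binomial-theorem : ∀ n t → poly (suc n) (bin n) t ≡ (1ℤ + t) ^ n
  binomial-theorem zero    t = refl
  binomial-theorem (suc n) t = begin
    poly (suc (suc n)) (bin (suc n)) t
      ≡⟨ add (poly (suc (suc n)) (bin (suc n)) t) (poly (suc (suc n)) (bin n) t) ⟩
    (poly (suc (suc n)) (bin (suc n)) t - poly (suc (suc n)) (bin n) t) + poly (suc (suc n)) (bin n) t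
      ≡⟨ cong₂ _+_ shifted top ⟩
    t * poly (suc n) (bin n) t + poly (suc n) (bin n) t
      ≡⟨ factor t (poly (suc n) (bin n) t) ⟩
    (1ℤ + t) * poly (suc n) (bin n) t
      ≡⟨ cong ((1ℤ + t) *_) (binomial-theorem n t) ⟩
    (1ℤ + t) * (1ℤ + t) ^ n ∎
    where
    open ≡-Reasoning
    add : ∀ x y → x ≡ (x - y) + y
    add = solve-∀
    factor : ∀ t x → t * x + x ≡ (1ℤ + t) * x
    factor = solve-∀
    difference : ∀ x y → (x + y) - y ≡ x
    difference = solve-∀
    shifted : poly (suc (suc n)) (bin (suc n)) t - poly (suc (suc n)) (bin n) t ≡ t * poly (suc n) (bin n) t
    shifted = trans (sym (poly-sub (suc (suc n)) (bin (suc n)) (bin n) t))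
      (poly-shift (suc n) (λ k → bin (suc n) k - bin n k) (bin n) t refl
        (λ k → trans (cong (_- bin n (suc k)) (pascal n k)) (difference (bin n k) (bin n (suc k)))))
    top : poly (suc (suc n)) (bin n) t ≡ poly (suc n) (bin n) t
    top = Σℤ-extend-≤ (λ k → bin n k * t ^ k) (ℕₚ.n≤1+n (suc n)) (λ k n<k → cong (_* t ^ k) (bin-vanishes n<k))

  bin-factorial : ∀ i j → bin (i ℕ.+ j) i * (+ (i !) * + (j !)) ≡ + ((i ℕ.+ j) !)
  bin-factorial i j = trans (cong (bin (i ℕ.+ j) i *_) (sym (ℤₚ.pos-* (i !) (j !))))
    (trans (sym (ℤₚ.pos-* ((i ℕ.+ j) C i) (i ! ℕ.* j !))) (cong +_ main))
    where
    instance
      _ = ℕₚ._!*_!≢0 i (i ℕ.+ j ℕ.∸ i)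
    i≤ : i ℕ.≤ i ℕ.+ j
    i≤ = ℕₚ.m≤m+n i j
    main : ((i ℕ.+ j) C i) ℕ.* (i ! ℕ.* j !) ≡ (i ℕ.+ j) !
    main = begin
      ((i ℕ.+ j) C i) ℕ.* (i ! ℕ.* j !)
        ≡⟨ cong (λ m → ((i ℕ.+ j) C i) ℕ.* (i ! ℕ.* m !)) (ℕₚ.m+n∸m≡n i j) ⟨
      ((i ℕ.+ j) C i) ℕ.* (i ! ℕ.* (i ℕ.+ j ℕ.∸ i) !)
        ≡⟨ cong (ℕ._* (i ! ℕ.* (i ℕ.+ j ℕ.∸ i) !)) (nCk≡n!/k![n-k]! i≤) ⟩
      ((i ℕ.+ j) ! ℕ./ (i ! ℕ.* (i ℕ.+ j ℕ.∸ i) !)) ℕ.* (i ! ℕ.* (i ℕ.+ j ℕ.∸ i) !)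
        ≡⟨ ℕ/.m/n*n≡m (k![n∸k]!∣n! i≤) ⟩
      (i ℕ.+ j) ! ∎
      where open ≡-Reasoning

  central-factorial : ∀ k → central k * (+ (k !) * + (k !)) ≡ + ((2 ℕ.* k) !)
  central-factorial k = subst (λ n → bin n k * (+ (k !) * + (k !)) ≡ + (n !))
                              (cong (k ℕ.+_) (sym (ℕₚ.+-identityʳ k))) (bin-factorial k k)

  cancel-! : ∀ n {x y} → x * + (n !) ≡ y * + (n !) → x ≡ y
  cancel-! n = ℤₚ.*-cancelʳ-≡ _ _ (+ (n !)) {{ℕₚ._!≢0 n}}

  -- For n = k + j both sides are (n+k)! / (k! k! j!); for n < k both vanish, since then n + k < 2k.
  bin-product : ∀ n k → bin n k * bin (n ℕ.+ k) k ≡ central k * bin (n ℕ.+ k) (k ℕ.+ k)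
  bin-product n k with n ℕ.<? k
  ... | yes n<k = trans (cong (_* bin (n ℕ.+ k) k) (bin-vanishes n<k))
                        (sym (trans (cong (central k *_) (bin-vanishes (ℕₚ.+-monoˡ-< k n<k))) (ℤₚ.*-zeroʳ (central k))))
  ... | no n≮k = subst (λ n → bin n k * bin (n ℕ.+ k) k ≡ central k * bin (n ℕ.+ k) (k ℕ.+ k))
                       (ℕₚ.m+[n∸m]≡n (ℕₚ.≮⇒≥ n≮k)) (main (n ℕ.∸ k))
    where
    open ≡-Reasoning
    main : ∀ j → bin (k ℕ.+ j) k * bin (k ℕ.+ j ℕ.+ k) k ≡ central k * bin (k ℕ.+ j ℕ.+ k) (k ℕ.+ k)
    main j = cancel-! k (cancel-! k (cancel-! j (begin
      X * Y * K * K * L        ≡⟨ regroup X Y K L ⟩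
      Y * (K * (X * (K * L)))  ≡⟨ cong (λ z → Y * (K * z)) (bin-factorial k j) ⟩
      Y * (K * + ((k ℕ.+ j) !)) ≡⟨ subst (λ n → bin n k * (K * + ((k ℕ.+ j) !)) ≡ + (n !)) (ℕₚ.+-comm k (k ℕ.+ j)) (bin-factorial k (k ℕ.+ j)) ⟩
      + ((k ℕ.+ j ℕ.+ k) !)    ≡⟨ subst (λ n → bin n (k ℕ.+ k) * (+ ((k ℕ.+ k) !) * L) ≡ + (n !)) k+k+j (bin-factorial (k ℕ.+ k) j) ⟨
      Z * (+ ((k ℕ.+ k) !) * L) ≡⟨ cong (λ z → Z * (z * L)) (trans (central-factorial k) (cong (λ n → + ((k ℕ.+ n) !)) (ℕₚ.+-identityʳ k))) ⟨
      Z * (W * (K * K) * L)    ≡⟨ regroup′ W Z K L ⟩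
      W * Z * K * K * L        ∎)))
      where
      X = bin (k ℕ.+ j) k
      Y = bin (k ℕ.+ j ℕ.+ k) k
      Z = bin (k ℕ.+ j ℕ.+ k) (k ℕ.+ k)
      W = central k
      K = + (k !)
      L = + (j !)
      k+k+j : k ℕ.+ k ℕ.+ j ≡ k ℕ.+ j ℕ.+ k
      k+k+j = trans (ℕₚ.+-assoc k k j) (trans (cong (k ℕ.+_) (ℕₚ.+-comm k j)) (sym (ℕₚ.+-assoc k j k)))
      regroup : ∀ X Y K L → X * Y * K * K * L ≡ Y * (K * (X * (K * L)))
      regroup = solve-∀
      regroup′ : ∀ W Z K L → Z * (W * (K * K) * L) ≡ W * Z * K * K * L
      regroup′ = solve-∀

  n∣n! : ∀ n .{{_ : ℕ.NonZero n}} → n ℕ∣.∣ n !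
  n∣n! (suc n) = ℕ∣.m∣m*n (n !)

  -- The residues of `G n x` and `V n x` for x congruent to a: the sign in their definition cancels
  -- the one in C(-1-a,k) = (-1)^k C(a+k,k).
  gSum vSum : ℕ → ℕ → ℤ
  gSum a n = Σℤ (suc n) (λ k → bin n k * leg a k)
  vSum a n = Σℤ (suc n) (λ k → bin n k * bin (n ℕ.+ k) k * leg a k)

  ^-distrib-* : ∀ x y n → (x * y) ^ n ≡ x ^ n * y ^ n
  ^-distrib-* x y zero    = refl
  ^-distrib-* x y (suc n) = trans (cong (x * y *_) (^-distrib-* x y n)) (swap x y (x ^ n) (y ^ n))
    where
    swap : ∀ x y a b → x * y * (a * b) ≡ x * a * (y * b)
    swap = solve-∀

  -- Congruence of integers modulo p.

  module Modulo (p : ℕ) where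

    infix 4 _≈_

    -- An explicit quotient turns compatibility with each operation into a ring identity after
    -- substitution.
    record _≈_ (x y : ℤ) : Set where
      constructor diff
      field
        {quotient} : ℤ
        equation   : x ≡ y + quotient * + p

    ≈-reflexive : ∀ {x y} → x ≡ y → x ≈ y
    ≈-reflexive {x} {y} x≡y = diff {quotient = 0ℤ} (trans x≡y (sym (ℤₚ.+-identityʳ y)))

    ≈-refl : ∀ {x} → x ≈ x
    ≈-refl = ≈-reflexive refl

    ≈-sym : ∀ {x y} → x ≈ y → y ≈ x
    ≈-sym {y = y} (diff {q} refl) = diff {quotient = - q} (step y q (+ p))
      where
      step : ∀ y q p → y ≡ y + q * p + - q * p
      step = solve-∀

    ≈-trans : ∀ {x y z} → x ≈ y → y ≈ z → x ≈ z
    ≈-trans {z = z} (diff {q} refl) (diff {r} refl) = diff {quotient = r + q} (step z q r (+ p))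
      where
      step : ∀ z q r p → z + r * p + q * p ≡ z + (r + q) * p
      step = solve-∀

    ≈-setoid : Setoid _ _
    ≈-setoid = record { Carrier = ℤ ; _≈_ = _≈_
                      ; isEquivalence = record { refl = ≈-refl ; sym = ≈-sym ; trans = ≈-trans } }

    open SetoidReasoning ≈-setoid

    +-cong : ∀ {x x′ y y′} → x ≈ x′ → y ≈ y′ → x + y ≈ x′ + y′
    +-cong {x′ = x} {y′ = y} (diff {q} refl) (diff {r} refl) = diff {quotient = q + r} (step x y q r (+ p))
      where
      step : ∀ x y q r p → x + q * p + (y + r * p) ≡ x + y + (q + r) * p
      step = solve-∀

    *-cong : ∀ {x x′ y y′} → x ≈ x′ → y ≈ y′ → x * y ≈ x′ * y′
    *-cong {x′ = x} {y′ = y} (diff {q} refl) (diff {r} refl) =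
      diff {quotient = q * y + x * r + q * r * + p} (step x y q r (+ p))
      where
      step : ∀ x y q r p → (x + q * p) * (y + r * p) ≡ x * y + (q * y + x * r + q * r * p) * p
      step = solve-∀

    *-congˡ : ∀ x {y y′} → y ≈ y′ → x * y ≈ x * y′
    *-congˡ x = *-cong (≈-refl {x})

    *-congʳ : ∀ y {x x′} → x ≈ x′ → x * y ≈ x′ * y
    *-congʳ y x≈x′ = *-cong x≈x′ (≈-refl {y})

    neg-cong : ∀ {x x′} → x ≈ x′ → - x ≈ - x′
    neg-cong {x′ = x} (diff {q} refl) = diff {quotient = - q} (step x q (+ p))
      where
      step : ∀ x q p → - (x + q * p) ≡ - x + - q * p
      step = solve-∀

    ^-cong : ∀ n {x y} → x ≈ y → x ^ n ≈ y ^ n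
    ^-cong zero    x≈y = ≈-refl
    ^-cong (suc n) x≈y = *-cong x≈y (^-cong n x≈y)

    Σℤ-≈ : ∀ {f g} n → (∀ k → k ℕ.< n → f k ≈ g k) → Σℤ n f ≈ Σℤ n g
    Σℤ-≈ zero    f≈g = ≈-refl
    Σℤ-≈ (suc n) f≈g = +-cong (Σℤ-≈ n (λ k k<n → f≈g k (ℕₚ.m<n⇒m<1+n k<n))) (f≈g n (ℕₚ.n<1+n n))

    p≈0 : + p ≈ 0ℤ
    p≈0 = diff {quotient = 1ℤ} (sym (trans (ℤₚ.+-identityˡ _) (ℤₚ.*-identityˡ (+ p))))

    multiple≈0 : ∀ x → + p * x ≈ 0ℤ
    multiple≈0 x = *-congʳ x p≈0

    ∣⇒≈0 : ∀ {x} → p ℕ∣.∣ ∣ x ∣ → x ≈ 0ℤ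
    ∣⇒≈0 p∣x with ℤ∣.∣ᵤ⇒∣ {+ p} p∣x
    ... | ℤ∣.divides q eq = diff {quotient = q} (trans eq (sym (ℤₚ.+-identityˡ (q * + p))))

    ≈0⇒∣ : ∀ {x} → x ≈ 0ℤ → p ℕ∣.∣ ∣ x ∣
    ≈0⇒∣ (diff {q} eq) = ℤ∣.∣⇒∣ᵤ (ℤ∣.divides q (trans eq (ℤₚ.+-identityˡ _)))

    _≈0? : ∀ x → Dec (x ≈ 0ℤ)
    x ≈0? = map′ ∣⇒≈0 ≈0⇒∣ (p ℕ∣.∣? ∣ x ∣)

    ≈⇒-≈0 : ∀ {x y} → x ≈ y → x - y ≈ 0ℤ
    ≈⇒-≈0 {y = y} x≈y = ≈-trans (+-cong x≈y (≈-refl { - y})) (≈-reflexive (ℤₚ.+-inverseʳ y))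

    -≈0⇒≈ : ∀ {x y} → x - y ≈ 0ℤ → x ≈ y
    -≈0⇒≈ {x} {y} x-y≈0 = ≈-trans (≈-reflexive (split x y)) (≈-trans (+-cong x-y≈0 (≈-refl {y})) (≈-reflexive (ℤₚ.+-identityˡ y)))
      where
      split : ∀ x y → x ≡ x - y + y
      split = solve-∀

    -- Arithmetic modulo a prime: cancellation, inverses, Fermat's little theorem.

    module Field (prime : Prime p) where

      instance
        p≢0 : ℕ.NonZero p
        p≢0 = prime⇒nonZero prime

      1<p : 1 ℕ.< p
      1<p = ℕ.nonTrivial⇒n>1 p {{prime⇒nonTrivial prime}}

      small≉0 : ∀ {k} → 0 ℕ.< k → k ℕ.< p → ¬ + k ≈ 0ℤ
      small≉0 {k} 0<k k<p k≈0 = ℕₚ.<⇒≱ k<p (ℕ∣.∣⇒≤ {{ℕ.>-nonZero 0<k}} (≈0⇒∣ k≈0))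

      *-≉0 : ∀ {x y} → ¬ x ≈ 0ℤ → ¬ y ≈ 0ℤ → ¬ x * y ≈ 0ℤ
      *-≉0 {x} {y} x≉0 y≉0 xy≈0
        with euclidsLemma ∣ x ∣ ∣ y ∣ prime (subst (p ℕ∣.∣_) (ℤₚ.abs-* x y) (≈0⇒∣ xy≈0))
      ... | inj₁ p∣x = x≉0 (∣⇒≈0 p∣x)
      ... | inj₂ p∣y = y≉0 (∣⇒≈0 p∣y)

      ≈-cancel : ∀ v {x y} → ¬ v ≈ 0ℤ → v * x ≈ v * y → x ≈ y
      ≈-cancel v {x} {y} v≉0 vx≈vy with (x - y) ≈0?
      ... | yes x-y≈0 = -≈0⇒≈ x-y≈0
      ... | no  x-y≉0 = ⊥-elim (*-≉0 v≉0 x-y≉0 (≈-trans (≈-reflexive (distrib v x y)) (≈⇒-≈0 vx≈vy)))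
        where
        distrib : ∀ v x y → v * (x - y) ≡ v * x - v * y
        distrib = solve-∀

      residue : ∀ x → ∃ λ a → (a ℕ.< p) × (x ≈ + a)
      residue x = x %ℕ p , n%ℕd<d x p , diff {quotient = x /ℕ p} (a≡a%ℕn+[a/ℕn]*n x p)

      inverse : ∀ x → ¬ x ≈ 0ℤ → ∃ λ y → x * y ≈ 1ℤ
      inverse x x≉0 with residue x
      ... | zero  , _   , x≈0 = ⊥-elim (x≉0 x≈0)
      ... | suc a , a<p , x≈a with coprime-Bézout (prime⇒coprime prime a<p)
      ...   | Bézout.+- u v eq = - + v , ≈-trans (*-congʳ (- + v) x≈a) (≈-sym (diff {quotient = + u} (step (+ u) (+ v) (+ suc a) (+ p)
              (trans (cong (λ z → 1ℤ + z) (sym (ℤₚ.pos-* v (suc a)))) (trans (cong +_ eq) (ℤₚ.pos-* u p))))))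
        where
        step : ∀ u v a p → 1ℤ + v * a ≡ u * p → 1ℤ ≡ a * - v + u * p
        step u v a p eq = trans (l v a) (cong (λ z → a * - v + z) eq)
          where
          l : ∀ v a → 1ℤ ≡ a * - v + (1ℤ + v * a)
          l = solve-∀
      ...   | Bézout.-+ u v eq = + v , ≈-trans (*-congʳ (+ v) x≈a) (diff {quotient = + u}
              (trans (ℤₚ.*-comm (+ suc a) (+ v)) (trans (sym (ℤₚ.pos-* v (suc a))) (trans (cong +_ (sym eq)) (cong (λ z → 1ℤ + z) (ℤₚ.pos-* u p))))))

      bin-p≈0 : ∀ {k} → suc k ℕ.< p → bin p (suc k) ≈ 0ℤ
      bin-p≈0 {k} k<p = ≈-cancel (+ suc k) (small≉0 (s≤s z≤n) k<p) (begin
        + suc k * bin p (suc k)                  ≡⟨ cong (λ n → + suc k * bin n (suc k)) (ℕₚ.suc-pred p) ⟨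
        + suc k * bin (suc (ℕ.pred p)) (suc k)   ≡⟨ absorption (ℕ.pred p) k ⟩
        + suc (ℕ.pred p) * bin (ℕ.pred p) k      ≡⟨ cong (λ n → + n * bin (ℕ.pred p) k) (ℕₚ.suc-pred p) ⟩
        + p * bin (ℕ.pred p) k                   ≈⟨ multiple≈0 (bin (ℕ.pred p) k) ⟩
        0ℤ                                       ≡⟨ ℤₚ.*-zeroʳ (+ suc k) ⟨
        + suc k * 0ℤ                             ∎)

      freshman : ∀ t → (1ℤ + t) ^ p ≈ 1ℤ + t ^ p
      freshman t = begin
        (1ℤ + t) ^ p                    ≡⟨ binomial-theorem p t ⟨
        poly p (bin p) t + bin p p * t ^ p ≈⟨ +-cong (middle p ℕₚ.≤-refl (ℕₚ.<-trans (s≤s z≤n) 1<p)) (≈-reflexive last) ⟩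
        1ℤ + t ^ p                      ∎
        where
        last : bin p p * t ^ p ≡ t ^ p
        last = trans (cong (λ n → + n * t ^ p) (nCn≡1 p)) (ℤₚ.*-identityˡ (t ^ p))
        middle : ∀ n → n ℕ.≤ p → 0 ℕ.< n → poly n (bin p) t ≈ 1ℤ
        middle (suc zero)    n≤p _ = ≈-refl
        middle (suc (suc n)) n≤p _ = +-cong (middle (suc n) (ℕₚ.<⇒≤ n≤p) (s≤s z≤n)) (*-congʳ (t ^ suc n) (bin-p≈0 n≤p))

      fermat-ℕ : ∀ a → (+ a) ^ p ≈ + a
      fermat-ℕ zero    = ≈-reflexive (trans (cong (λ n → 0ℤ ^ n) (sym (ℕₚ.suc-pred p))) refl)
      fermat-ℕ (suc a) = ≈-trans (freshman (+ a)) (+-cong (≈-refl {1ℤ}) (fermat-ℕ a))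

      fermat : ∀ t → t ^ p ≈ t
      fermat t with residue t
      ... | a , _ , t≈a = ≈-trans (^-cong p t≈a) (≈-trans (fermat-ℕ a) (≈-sym t≈a))

      !≉0 : ∀ k → k ℕ.< p → ¬ + (k !) ≈ 0ℤ
      !≉0 zero    0<p = small≉0 (s≤s z≤n) 1<p
      !≉0 (suc k) k<p = subst (λ z → ¬ z ≈ 0ℤ) (sym (ℤₚ.pos-* (suc k) (k !)))
                          (*-≉0 (small≉0 (s≤s z≤n) k<p) (!≉0 k (ℕₚ.<-trans (ℕₚ.n<1+n k) k<p)))

      -- The factorial (2k)! contains the factor p, while k! does not.
      central≈0 : ∀ {k} → k ℕ.< p → p ℕ.≤ 2 ℕ.* k → central k ≈ 0ℤ
      central≈0 {k} k<p p≤2k = ≈-cancel (K * K) (*-≉0 (!≉0 k k<p) (!≉0 k k<p)) (begin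
        K * K * central k   ≡⟨ ℤₚ.*-comm (K * K) (central k) ⟩
        central k * (K * K) ≡⟨ central-factorial k ⟩
        + ((2 ℕ.* k) !)     ≈⟨ ∣⇒≈0 (ℕ∣.∣-trans (n∣n! p) (ℕ∣.m≤n⇒m!∣n! p≤2k)) ⟩
        0ℤ                  ≡⟨ ℤₚ.*-zeroʳ (K * K) ⟨
        K * K * 0ℤ          ∎)
        where
        K = + (k !)

      -- Generating sums over n < p modulo p.

      module Sums (t w : ℤ) (inverts : (1ℤ - t) * w ≈ 1ℤ) where

        y : ℤ
        y = t * w

        1+y≈w : 1ℤ + y ≈ w
        1+y≈w = ≈-trans (+-cong (≈-sym inverts) (≈-refl {y})) (≈-reflexive (collect t w))
          where
          collect : ∀ t w → (1ℤ - t) * w + t * w ≡ w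
          collect = solve-∀

        divide : ∀ x z → (1ℤ - t) * x ≈ z → x ≈ w * z
        divide x z eq = begin
          x                     ≡⟨ ℤₚ.*-identityˡ x ⟨
          1ℤ * x                ≈⟨ *-congʳ x inverts ⟨
          (1ℤ - t) * w * x      ≡⟨ swap (1ℤ - t) w x ⟩
          w * ((1ℤ - t) * x)    ≈⟨ *-congˡ w eq ⟩
          w * z                 ∎
          where
          swap : ∀ a w x → a * w * x ≡ w * (a * x)
          swap = solve-∀

        column : ℕ → ℤ
        column k = poly p (λ n → bin n k) t

        geometric : ∀ n → (1ℤ - t) * poly n (λ n → bin n 0) t ≡ 1ℤ - t ^ n
        geometric zero    = ℤₚ.*-zeroʳ (1ℤ - t)
        geometric (suc n) = trans (expand t (poly n (λ n → bin n 0) t) (t ^ n))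
          (trans (cong (λ z → z + (1ℤ - t) * t ^ n) (geometric n)) (collect t (t ^ n)))
          where
          expand : ∀ t s x → (1ℤ - t) * (s + 1ℤ * x) ≡ (1ℤ - t) * s + (1ℤ - t) * x
          expand = solve-∀
          collect : ∀ t x → 1ℤ - x + (1ℤ - t) * x ≡ 1ℤ - t * x
          collect = solve-∀

        -- Pascal's rule gives column(k+1) = t (column k + column(k+1)) up to the boundary term
        -- C(p,k+1) t^p, which p divides because 0 < k+1 < p. Dividing by 1 - t yields the factor y.
        column-step : ∀ k → suc k ℕ.< p → column (suc k) ≈ y * column k
        column-step k k<p = ≈-trans (divide (column (suc k)) (t * column k) shifted) (≈-reflexive (regroup t w (column k)))
          where
          regroup : ∀ t w x → w * (t * x) ≡ t * w * x
          regroup = solve-∀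
          split : ∀ n (d e : ℕ → ℤ) → poly n (λ k → d k + e k) t ≡ poly n d t + poly n e t
          split n d e = trans (Σℤ-cong n (λ k _ → ℤₚ.*-distribʳ-+ (t ^ k) (d k) (e k))) (Σℤ-+ n (λ k → d k * t ^ k) (λ k → e k * t ^ k))
          whole : column (suc k) + bin p (suc k) * t ^ p ≡ t * (column k + column (suc k))
          whole = trans (poly-shift p (λ n → bin n (suc k)) (λ n → bin n k + bin n (suc k)) t (bin-vanishes {0} {suc k} (s≤s z≤n)) (λ n → pascal n k))
                        (cong (t *_) (split p (λ n → bin n k) (λ n → bin n (suc k))))
          expand : ∀ t x → (1ℤ - t) * x ≡ x + 0ℤ - t * x
          expand = solve-∀
          collect : ∀ t c x → t * (c + x) - t * x ≡ t * c
          collect = solve-∀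
          shifted : (1ℤ - t) * column (suc k) ≈ t * column k
          shifted = begin
            (1ℤ - t) * column (suc k)                                         ≡⟨ expand t (column (suc k)) ⟩
            column (suc k) + 0ℤ - t * column (suc k)
              ≈⟨ +-cong (+-cong (≈-refl {column (suc k)}) (*-congʳ (t ^ p) (bin-p≈0 k<p))) (≈-refl { - (t * column (suc k))}) ⟨
            column (suc k) + bin p (suc k) * t ^ p - t * column (suc k)       ≡⟨ cong (_- t * column (suc k)) whole ⟩
            t * (column k + column (suc k)) - t * column (suc k)              ≡⟨ collect t (column k) (column (suc k)) ⟩
            t * column k                                                      ∎

        column≈ : ∀ k → k ℕ.< p → column k ≈ y ^ k
        -- The truncated geometric series is (1 - t^p)/(1 - t), and Fermat replaces t^p by t, which
        -- leaves 1.
        column≈ zero    _   = begin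
          column 0          ≈⟨ divide (column 0) (1ℤ - t ^ p) (≈-reflexive (geometric p)) ⟩
          w * (1ℤ - t ^ p)  ≈⟨ *-congˡ w (+-cong (≈-refl {1ℤ}) (neg-cong (fermat t))) ⟩
          w * (1ℤ - t)      ≡⟨ ℤₚ.*-comm w (1ℤ - t) ⟩
          (1ℤ - t) * w      ≈⟨ inverts ⟩
          1ℤ                ∎
        column≈ (suc k) k<p = ≈-trans (column-step k k<p) (*-congˡ y (column≈ k (ℕₚ.<-trans (ℕₚ.n<1+n k) k<p)))

        -- Only e = s = k is wanted, but Pascal's rule on a step in s leads to the pairs (s, e) and
        -- (s, e+1), so e and s must vary separately. The two results combine to the factor 1 + y,
        -- congruent to w, and e + s never exceeds its initial value.
        diagonal≈ : ∀ s e → e ℕ.+ s ℕ.< p → poly p (λ n → bin (n ℕ.+ s) (e ℕ.+ s)) t ≈ y ^ e * w ^ s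
        diagonal≈ zero e e<p = begin
          poly p (λ n → bin (n ℕ.+ 0) (e ℕ.+ 0)) t
            ≡⟨ poly-cong p t (λ n → cong₂ bin (ℕₚ.+-identityʳ n) (ℕₚ.+-identityʳ e)) ⟩
          column e      ≈⟨ column≈ e (subst (ℕ._< p) (ℕₚ.+-identityʳ e) e<p) ⟩
          y ^ e         ≡⟨ ℤₚ.*-identityʳ (y ^ e) ⟨
          y ^ e * 1ℤ    ∎
        diagonal≈ (suc s) e e+s<p = begin
          poly p (λ n → bin (n ℕ.+ suc s) (e ℕ.+ suc s)) t
            ≡⟨ Σℤ-cong p (λ n _ → trans (cong (_* t ^ n) (trans (cong₂ bin (ℕₚ.+-suc n s) (ℕₚ.+-suc e s)) (pascal (n ℕ.+ s) (e ℕ.+ s))))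
                                       (ℤₚ.*-distribʳ-+ (t ^ n) (bin (n ℕ.+ s) (e ℕ.+ s)) (bin (n ℕ.+ s) (suc e ℕ.+ s)))) ⟩
          Σℤ p (λ n → bin (n ℕ.+ s) (e ℕ.+ s) * t ^ n + bin (n ℕ.+ s) (suc e ℕ.+ s) * t ^ n)
            ≡⟨ Σℤ-+ p (λ n → bin (n ℕ.+ s) (e ℕ.+ s) * t ^ n) (λ n → bin (n ℕ.+ s) (suc e ℕ.+ s) * t ^ n) ⟩
          poly p (λ n → bin (n ℕ.+ s) (e ℕ.+ s)) t + poly p (λ n → bin (n ℕ.+ s) (suc e ℕ.+ s)) t
            ≈⟨ +-cong (diagonal≈ s e (ℕₚ.<-trans (ℕₚ.n<1+n (e ℕ.+ s)) 1+e+s<p)) (diagonal≈ s (suc e) 1+e+s<p) ⟩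
          y ^ e * w ^ s + y ^ suc e * w ^ s   ≡⟨ factor y (y ^ e) (w ^ s) ⟩
          y ^ e * ((1ℤ + y) * w ^ s)          ≈⟨ *-congˡ (y ^ e) (*-congʳ (w ^ s) 1+y≈w) ⟩
          y ^ e * w ^ suc s                   ∎
          where
          1+e+s<p : suc e ℕ.+ s ℕ.< p
          1+e+s<p = subst (ℕ._< p) (ℕₚ.+-suc e s) e+s<p
          factor : ∀ y a b → a * b + y * a * b ≡ a * ((1ℤ + y) * b)
          factor = solve-∀

        central-diagonal≈ : ∀ k → k ℕ.< p → central k * poly p (λ n → bin (n ℕ.+ k) (k ℕ.+ k)) t ≈ central k * (y * w) ^ k
        central-diagonal≈ k k<p with k ℕ.+ k ℕ.<? p
        ... | yes 2k<p = *-congˡ (central k) (≈-trans (diagonal≈ k k 2k<p) (≈-reflexive (sym (^-distrib-* y w k))))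
        ... | no 2k≮p = ≈-trans (vanish _) (≈-sym (vanish ((y * w) ^ k)))
          where
          vanish : ∀ x → central k * x ≈ 0ℤ
          vanish x = *-congʳ x (central≈0 k<p (subst (p ℕ.≤_) (cong (k ℕ.+_) (sym (ℕₚ.+-identityʳ k))) (ℕₚ.≮⇒≥ 2k≮p)))

        swapped : ∀ (f : ℕ → ℕ → ℤ) (l : ℕ → ℤ) →
                  Σℤ p (λ n → Σℤ p (λ k → f n k * l k) * t ^ n) ≡ Σℤ p (λ k → poly p (λ n → f n k) t * l k)
        swapped f l =
          trans (Σℤ-cong p (λ n _ → Σℤ-*ʳ p (λ k → f n k * l k) (t ^ n)))
          (trans (Σℤ-swap p p (λ n k → f n k * l k * t ^ n))
          (Σℤ-cong p (λ k _ → trans (Σℤ-cong p (λ n _ → swap (f n k) (l k) (t ^ n))) (sym (Σℤ-*ʳ p (λ n → f n k * t ^ n) (l k))))))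
          where
          swap : ∀ f l x → f * l * x ≡ f * x * l
          swap = solve-∀

        gSums≈ : ∀ a → poly p (gSum a) t ≈ P p a y
        gSums≈ a = begin
          poly p (gSum a) t
            -- The inner range is enlarged from k ≤ n to k < p by vanishing binomial coefficients,
            -- so that the double sum runs over a square and can be interchanged.
            ≡⟨ Σℤ-cong p (λ n n<p → cong (_* t ^ n) (sym (Σℤ-extend-≤ (λ k → bin n k * leg a k) n<p
                 (λ k n<k → cong (_* leg a k) (bin-vanishes n<k))))) ⟩
          Σℤ p (λ n → Σℤ p (λ k → bin n k * leg a k) * t ^ n)
            ≡⟨ swapped bin (leg a) ⟩
          Σℤ p (λ k → column k * leg a k)
            ≈⟨ Σℤ-≈ p (λ k k<p → ≈-trans (*-congʳ (leg a k) (column≈ k k<p)) (≈-reflexive (ℤₚ.*-comm (y ^ k) (leg a k)))) ⟩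
          P p a y ∎

        vSums≈ : ∀ a → poly p (vSum a) t ≈ H p a (y * w)
        vSums≈ a = begin
          poly p (vSum a) t
            ≡⟨ Σℤ-cong p (λ n n<p → cong (_* t ^ n) (sym (Σℤ-extend-≤ (λ k → bin n k * bin (n ℕ.+ k) k * leg a k) n<p
                 (λ k n<k → cong (λ z → z * bin (n ℕ.+ k) k * leg a k) (bin-vanishes n<k))))) ⟩
          Σℤ p (λ n → Σℤ p (λ k → bin n k * bin (n ℕ.+ k) k * leg a k) * t ^ n)
            ≡⟨ Σℤ-cong p (λ n _ → cong (_* t ^ n) (Σℤ-cong p (λ k _ → cong (_* leg a k) (bin-product n k)))) ⟩
          Σℤ p (λ n → Σℤ p (λ k → central k * bin (n ℕ.+ k) (k ℕ.+ k) * leg a k) * t ^ n)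
            ≡⟨ swapped (λ n k → central k * bin (n ℕ.+ k) (k ℕ.+ k)) (leg a) ⟩
          Σℤ p (λ k → poly p (λ n → central k * bin (n ℕ.+ k) (k ℕ.+ k)) t * leg a k)
            ≡⟨ Σℤ-cong p (λ k _ → cong (_* leg a k) (poly-scale p (central k) (λ n → bin (n ℕ.+ k) (k ℕ.+ k)) t)) ⟩
          Σℤ p (λ k → central k * poly p (λ n → bin (n ℕ.+ k) (k ℕ.+ k)) t * leg a k)
            ≈⟨ Σℤ-≈ p (λ k k<p → ≈-trans (*-congʳ (leg a k) (central-diagonal≈ k k<p)) (≈-reflexive (swap (central k) ((y * w) ^ k) (leg a k)))) ⟩
          H p a (y * w) ∎
          where
          swap : ∀ c u l → c * u * l ≡ c * l * u
          swap = solve-∀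

        poly-≈ : ∀ n d {u u′} → u ≈ u′ → poly n d u ≈ poly n d u′
        poly-≈ n d u≈u′ = Σℤ-≈ n (λ k _ → *-congˡ (d k) (^-cong k u≈u′))

        gSums-squared≈ : ∀ a → a ℕ.< p → poly p (gSum a) t * poly p (gSum a) t ≈ H p a (y * w)
        gSums-squared≈ a a<p = begin
          poly p (gSum a) t * poly p (gSum a) t  ≈⟨ *-cong (gSums≈ a) (gSums≈ a) ⟩
          P p a y * P p a y                      ≡⟨ clausen p a y a<p 1<p ⟩
          H p a (y * (1ℤ + y))                   ≈⟨ poly-≈ p (h a) (*-congˡ y 1+y≈w) ⟩
          H p a (y * w)                          ∎

  -- Factorial quotients and the binomial products of the three special cases.

  -- The product (x+1)(x+2)...(x+r), which is (x+r)!/x! for natural x.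
  rise : ℕ → ℤ → ℤ
  rise zero    x = 1ℤ
  rise (suc r) x = (+ suc r + x) * rise r x

  !-rise : ∀ r n → + ((r ℕ.+ n) !) ≡ rise r (+ n) * + (n !)
  !-rise zero    n = sym (ℤₚ.*-identityˡ (+ (n !)))
  !-rise (suc r) n = trans (ℤₚ.pos-* (suc r ℕ.+ n) ((r ℕ.+ n) !))
    (trans (cong ((+ suc r + + n) *_) (!-rise r n)) (sym (ℤₚ.*-assoc (+ suc r + + n) (rise r (+ n)) (+ (n !)))))

  !-step : ∀ r k → + ((r ℕ.* suc k) !) ≡ rise r (+ r * + k) * + ((r ℕ.* k) !)
  !-step r k = trans (cong (λ n → + (n !)) (ℕₚ.*-suc r k))
    (trans (!-rise r (r ℕ.* k)) (cong (λ z → rise r z * + ((r ℕ.* k) !)) (ℤₚ.pos-* r k)))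

  -- For w = t/d and w′ = t′/d′ with d′ = δd and t′ = τt, the quotient w′/w is τ/δ, which the last
  -- hypothesis says is ρ/s. The denominator d′ is a product of three factorials, hence can be
  -- cancelled.
  ratio : ∀ i j l {d w t w′ t′} s τ δ ρ → w * d ≡ t → w′ * (+ (i !) * + (j !) * + (l !)) ≡ t′ →
          + (i !) * + (j !) * + (l !) ≡ δ * d → t′ ≡ τ * t → s * τ ≡ ρ * δ → s * w′ ≡ ρ * w
  ratio i j l {d} {w} {t} {w′} {t′} s τ δ ρ wd w′d′ d′ tt eq = cancel-! i (cancel-! j (cancel-! l (begin
    s * w′ * I * M * L            ≡⟨ regroup s w′ I M L ⟩
    s * (w′ * (I * M * L))        ≡⟨ cong (s *_) (trans w′d′ tt) ⟩
    s * (τ * t)                   ≡⟨ ℤₚ.*-assoc s τ t ⟨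
    s * τ * t                     ≡⟨ cong₂ _*_ eq (sym wd) ⟩
    ρ * δ * (w * d)               ≡⟨ swap ρ δ w d ⟩
    ρ * (w * (δ * d))             ≡⟨ cong (λ z → ρ * (w * z)) d′ ⟨
    ρ * (w * (I * M * L))         ≡⟨ regroup ρ w I M L ⟨
    ρ * w * I * M * L             ∎)) )
    where
    open ≡-Reasoning
    I = + (i !)
    M = + (j !)
    L = + (l !)
    regroup : ∀ s w i j l → s * w * i * j * l ≡ s * (w * (i * j * l))
    regroup = solve-∀
    swap : ∀ ρ δ w d → ρ * δ * (w * d) ≡ ρ * (w * (δ * d))
    swap = solve-∀

  -- The multinomial numbers (3k)!/k!³, (4k)!/(k!² (2k)!) and (6k)!/(k! (2k)! (3k)!).
  w₃ w₄ w₆ : ℕ → ℤ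
  w₃ k = central k * bin (3 ℕ.* k) k
  w₄ k = central k * bin (4 ℕ.* k) (2 ℕ.* k)
  w₆ k = bin (3 ℕ.* k) k * bin (6 ℕ.* k) (3 ℕ.* k)

  w₃-factorial : ∀ k → w₃ k * (+ (k !) * + (k !) * + (k !)) ≡ + ((3 ℕ.* k) !)
  w₃-factorial k = trans (regroup (central k) (bin (3 ℕ.* k) k) (+ (k !)))
    (trans (cong (λ z → bin (3 ℕ.* k) k * (+ (k !) * z)) (central-factorial k)) (bin-factorial k (2 ℕ.* k)))
    where
    regroup : ∀ c b f → c * b * (f * f * f) ≡ b * (f * (c * (f * f)))
    regroup = solve-∀

  w₄-factorial : ∀ k → w₄ k * (+ (k !) * + (k !) * + ((2 ℕ.* k) !)) ≡ + ((4 ℕ.* k) !)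
  w₄-factorial k = trans (regroup (central k) (bin (4 ℕ.* k) (2 ℕ.* k)) (+ (k !)) (+ ((2 ℕ.* k) !)))
    (trans (cong (λ z → bin (4 ℕ.* k) (2 ℕ.* k) * (z * + ((2 ℕ.* k) !))) (central-factorial k))
      (subst (λ n → bin n (2 ℕ.* k) * (+ ((2 ℕ.* k) !) * + ((2 ℕ.* k) !)) ≡ + (n !))
             (sym (ℕₚ.*-distribʳ-+ k 2 2)) (bin-factorial (2 ℕ.* k) (2 ℕ.* k))))
    where
    regroup : ∀ c b f g → c * b * (f * f * g) ≡ b * (c * (f * f) * g)
    regroup = solve-∀

  w₆-factorial : ∀ k → w₆ k * (+ (k !) * + ((2 ℕ.* k) !) * + ((3 ℕ.* k) !)) ≡ + ((6 ℕ.* k) !)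
  w₆-factorial k = trans (regroup (bin (3 ℕ.* k) k) (bin (6 ℕ.* k) (3 ℕ.* k)) (+ (k !)) (+ ((2 ℕ.* k) !)) (+ ((3 ℕ.* k) !)))
    (trans (cong (λ z → bin (6 ℕ.* k) (3 ℕ.* k) * (z * + ((3 ℕ.* k) !))) (bin-factorial k (2 ℕ.* k)))
      (subst (λ n → bin n (3 ℕ.* k) * (+ ((3 ℕ.* k) !) * + ((3 ℕ.* k) !)) ≡ + (n !))
             (sym (ℕₚ.*-distribʳ-+ k 3 3)) (bin-factorial (3 ℕ.* k) (3 ℕ.* k))))
    where
    regroup : ∀ c b f g h → c * b * (f * g * h) ≡ b * (c * (f * g) * h)
    regroup = solve-∀

  -- All three cases share the shape (k+1)² w(k+1) = d (rk+1)(rk+r-1) w(k) with d = c/r², that is d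
  -- = 3, 4, 12 for r = 3, 4, 6. This is the term ratio of c^k C(-1/r,k) C(1/r-1,k).
  w₃-step : ∀ k → + suc k * + suc k * w₃ (suc k) ≡ + 3 * (+ 3 * + k + 1ℤ) * (+ 3 * + k + + 2) * w₃ k
  w₃-step k = ratio (suc k) (suc k) (suc k) (+ suc k * + suc k) (rise 3 (+ 3 * + k)) (+ suc k * + suc k * + suc k)
    (+ 3 * (+ 3 * + k + 1ℤ) * (+ 3 * + k + + 2)) (w₃-factorial k) (w₃-factorial (suc k))
    (trans (cong (λ z → z * z * z) (ℤₚ.pos-* (suc k) (k !))) (collect (+ suc k) (+ (k !)))) (!-step 3 k) (rates (+ k))
    where
    collect : ∀ k f → (k * f) * (k * f) * (k * f) ≡ k * k * k * (f * f * f)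
    collect = solve-∀
    rates : ∀ k → (1ℤ + k) * (1ℤ + k) * ((+ 3 + + 3 * k) * ((+ 2 + + 3 * k) * ((1ℤ + + 3 * k) * 1ℤ)))
                ≡ + 3 * (+ 3 * k + 1ℤ) * (+ 3 * k + + 2) * ((1ℤ + k) * (1ℤ + k) * (1ℤ + k))
    rates = solve-∀

  w₄-step : ∀ k → + suc k * + suc k * w₄ (suc k) ≡ + 4 * (+ 4 * + k + 1ℤ) * (+ 4 * + k + + 3) * w₄ k
  w₄-step k = ratio (suc k) (suc k) (2 ℕ.* suc k) (+ suc k * + suc k) (rise 4 (+ 4 * + k)) (+ suc k * + suc k * rise 2 (+ 2 * + k))
    (+ 4 * (+ 4 * + k + 1ℤ) * (+ 4 * + k + + 3)) (w₄-factorial k) (w₄-factorial (suc k))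
    (trans (cong₂ (λ z g → z * z * g) (ℤₚ.pos-* (suc k) (k !)) (!-step 2 k)) (collect (+ suc k) (+ (k !)) (rise 2 (+ 2 * + k)) (+ ((2 ℕ.* k) !))))
    (!-step 4 k) (rates (+ k))
    where
    collect : ∀ k f r g → (k * f) * (k * f) * (r * g) ≡ k * k * r * (f * f * g)
    collect = solve-∀
    rates : ∀ k → (1ℤ + k) * (1ℤ + k) * ((+ 4 + + 4 * k) * ((+ 3 + + 4 * k) * ((+ 2 + + 4 * k) * ((1ℤ + + 4 * k) * 1ℤ))))
                ≡ + 4 * (+ 4 * k + 1ℤ) * (+ 4 * k + + 3) * ((1ℤ + k) * (1ℤ + k) * ((+ 2 + + 2 * k) * ((1ℤ + + 2 * k) * 1ℤ)))
    rates = solve-∀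

  w₆-step : ∀ k → + suc k * + suc k * w₆ (suc k) ≡ + 12 * (+ 6 * + k + 1ℤ) * (+ 6 * + k + + 5) * w₆ k
  w₆-step k = ratio (suc k) (2 ℕ.* suc k) (3 ℕ.* suc k) (+ suc k * + suc k) (rise 6 (+ 6 * + k))
    (+ suc k * rise 2 (+ 2 * + k) * rise 3 (+ 3 * + k))
    (+ 12 * (+ 6 * + k + 1ℤ) * (+ 6 * + k + + 5)) (w₆-factorial k) (w₆-factorial (suc k))
    (trans (cong₂ _*_ (cong₂ _*_ (ℤₚ.pos-* (suc k) (k !)) (!-step 2 k)) (!-step 3 k))
           (collect (+ suc k) (+ (k !)) (rise 2 (+ 2 * + k)) (+ ((2 ℕ.* k) !)) (rise 3 (+ 3 * + k)) (+ ((3 ℕ.* k) !))))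
    (!-step 6 k) (rates (+ k))
    where
    collect : ∀ k f r g r′ g′ → (k * f) * (r * g) * (r′ * g′) ≡ k * r * r′ * (f * g * g′)
    collect = solve-∀
    rates : ∀ k → (1ℤ + k) * (1ℤ + k) * ((+ 6 + + 6 * k) * ((+ 5 + + 6 * k) * ((+ 4 + + 6 * k)
                    * ((+ 3 + + 6 * k) * ((+ 2 + + 6 * k) * ((1ℤ + + 6 * k) * 1ℤ))))))
                ≡ + 12 * (+ 6 * k + 1ℤ) * (+ 6 * k + + 5)
                    * ((1ℤ + k) * ((+ 2 + + 2 * k) * ((1ℤ + + 2 * k) * 1ℤ)) * ((+ 3 + + 3 * k) * ((+ 2 + + 3 * k) * ((1ℤ + + 3 * k) * 1ℤ))))
    rates = solve-∀

  -- Integers inside the rationals.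

  embed : ℤ → ℚ
  embed z = z ℚ./ 1

  -- Arithmetic of reduced fractions is checked on unnormalised representatives, where no gcd blocks
  -- the computation.
  embed-cong-≃ : ∀ {q} z → toℚᵘ q ℚᵘ.≃ mkℚᵘ z 0 → q ≡ embed z
  embed-cong-≃ z q≃z = ℚₚ.toℚᵘ-injective (ℚᵘₚ.≃-trans q≃z (ℚᵘₚ.≃-sym (ℚₚ.toℚᵘ-fromℚᵘ (mkℚᵘ z 0))))

  embed-≃ : ∀ z → toℚᵘ (embed z) ℚᵘ.≃ mkℚᵘ z 0
  embed-≃ z = ℚₚ.toℚᵘ-fromℚᵘ (mkℚᵘ z 0)

  embed-+ : ∀ x y → embed x ℚ.+ embed y ≡ embed (x + y)
  embed-+ x y = embed-cong-≃ (x + y) (ℚᵘₚ.≃-trans (ℚₚ.toℚᵘ-homo-+ (embed x) (embed y))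
    (ℚᵘₚ.≃-trans (ℚᵘₚ.+-cong (embed-≃ x) (embed-≃ y)) (*≡* (cong (_* 1ℤ) (cong₂ _+_ (ℤₚ.*-identityʳ x) (ℤₚ.*-identityʳ y))))))

  embed-* : ∀ x y → embed x ℚ.* embed y ≡ embed (x * y)
  embed-* x y = embed-cong-≃ (x * y) (ℚᵘₚ.≃-trans (ℚₚ.toℚᵘ-homo-* (embed x) (embed y))
    (ℚᵘₚ.≃-trans (ℚᵘₚ.*-cong (embed-≃ x) (embed-≃ y)) (*≡* refl)))

  embed-neg : ∀ x → ℚ.- embed x ≡ embed (- x)
  embed-neg x = embed-cong-≃ (- x) (ℚᵘₚ.≃-trans (ℚₚ.toℚᵘ-homo‿- (embed x)) (ℚᵘₚ.-‿cong (embed-≃ x)))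

  embed-injective : ∀ {x y} → embed x ≡ embed y → x ≡ y
  embed-injective {x} {y} eq with ℚᵘₚ.≃-trans (ℚᵘₚ.≃-sym (embed-≃ x)) (ℚᵘₚ.≃-trans (ℚₚ.toℚᵘ-cong eq) (embed-≃ y))
  ... | *≡* x≡y = trans (sym (ℤₚ.*-identityʳ x)) (trans x≡y (ℤₚ.*-identityʳ y))

  *-denominator : ∀ q → q ℚ.* embed (↧ q) ≡ embed (↥ q)
  *-denominator q@(mkℚ n d _) = embed-cong-≃ n (ℚᵘₚ.≃-trans (ℚₚ.toℚᵘ-homo-* q (embed (↧ q)))
    (ℚᵘₚ.≃-trans (ℚᵘₚ.*-congˡ {toℚᵘ q} (embed-≃ (↧ q))) (*≡* (trans (ℤₚ.*-identityʳ (n * + suc d)) (cong (λ m → n * + m) (sym (ℕₚ.*-identityʳ (suc d))))))))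

  reciprocal-* : ∀ k → ((+ 1) ℚ./ suc k) ℚ.* embed (+ suc k) ≡ 1ℚ
  reciprocal-* k = embed-cong-≃ 1ℤ (ℚᵘₚ.≃-trans (ℚₚ.toℚᵘ-homo-* ((+ 1) ℚ./ suc k) (embed (+ suc k)))
    (ℚᵘₚ.≃-trans (ℚᵘₚ.*-cong (ℚₚ.toℚᵘ-fromℚᵘ (mkℚᵘ (+ 1) k)) (embed-≃ (+ suc k)))
      (*≡* (trans (ℤₚ.*-identityʳ (+ 1 * + suc k)) (cong (λ m → + 1 * + m) (sym (ℕₚ.*-identityʳ (suc k))))))))

  unscaled : ∀ k z → z ≡ z ℚ.* ((+ 1) ℚ./ suc k) ℚ.* embed (+ suc k)
  unscaled k z = sym (trans (ℚₚ.*-assoc z ((+ 1) ℚ./ suc k) (embed (+ suc k)))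
                            (trans (cong (z ℚ.*_) (reciprocal-* k)) (ℚₚ.*-identityʳ z)))

  inv-* : ∀ {q} → ¬ q ≡ 0ℚ → D.inv q ℚ.* q ≡ 1ℚ
  inv-* {q} q≢0 with q ℚₚ.≟ 0ℚ
  ... | yes q≡0 = ⊥-elim (q≢0 q≡0)
  ... | no  q≢0′ = ℚₚ.*-inverseˡ q {{ℚ.≢-nonZero q≢0′}}

  pos-square-* : ∀ x y → + (x ℕ.^ 2 ℕ.* y) ≡ + x * (+ x * + y)
  pos-square-* x y = trans (ℤₚ.pos-* (x ℕ.^ 2) y) (trans (cong (_* + y) (trans (ℤₚ.pos-* x (x ℕ.* 1))
    (cong (λ n → + x * + n) (ℕₚ.*-identityʳ x)))) (ℤₚ.*-assoc (+ x) (+ x) (+ y)))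

  binomials₃ : ∀ k → + (((2 ℕ.* k) C k) ℕ.^ 2 ℕ.* ((3 ℕ.* k) C k)) ≡ central k * w₃ k
  binomials₃ k = pos-square-* ((2 ℕ.* k) C k) ((3 ℕ.* k) C k)

  binomials₄ : ∀ k → + (((2 ℕ.* k) C k) ℕ.^ 2 ℕ.* ((4 ℕ.* k) C (2 ℕ.* k))) ≡ central k * w₄ k
  binomials₄ k = pos-square-* ((2 ℕ.* k) C k) ((4 ℕ.* k) C (2 ℕ.* k))

  binomials₆ : ∀ k → + (((2 ℕ.* k) C k) ℕ.* ((3 ℕ.* k) C k) ℕ.* ((6 ℕ.* k) C (3 ℕ.* k))) ≡ central k * w₆ k
  binomials₆ k = trans (ℤₚ.pos-* (((2 ℕ.* k) C k) ℕ.* ((3 ℕ.* k) C k)) ((6 ℕ.* k) C (3 ℕ.* k)))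
    (trans (cong (_* bin (6 ℕ.* k) (3 ℕ.* k)) (ℤₚ.pos-* ((2 ℕ.* k) C k) ((3 ℕ.* k) C k)))
           (ℤₚ.*-assoc (central k) (bin (3 ℕ.* k) k) (bin (6 ℕ.* k) (3 ℕ.* k))))

  -- Reduction of p-integral rationals modulo p.

  module Reduction (p : ℕ) (prime : Prime p) where

    open Modulo p
    open Field prime

    1≉0 : ¬ 1ℤ ≈ 0ℤ
    1≉0 = small≉0 (s≤s z≤n) 1<p

    -- q ↦ n: q lies in ℤ_p and is congruent to the integer n modulo p.
    record _↦_ (q : ℚ) (n : ℤ) : Set where
      constructor reduction
      field
        num den   : ℤ
        den≉0     : ¬ den ≈ 0ℤ
        fraction  : q ℚ.* embed den ≡ embed num
        num≈      : num ≈ n * den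

    infix 4 _↦_

    ↦-embed : ∀ z → embed z ↦ z
    ↦-embed z = reduction z 1ℤ 1≉0 (ℚₚ.*-identityʳ (embed z)) (≈-reflexive (sym (ℤₚ.*-identityʳ z)))

    ↦-≈ : ∀ {q m n} → q ↦ m → m ≈ n → q ↦ n
    ↦-≈ (reduction u v v≉0 qv num≈) m≈n = reduction u v v≉0 qv (≈-trans num≈ (*-congʳ v m≈n))

    ↦-≡ : ∀ {q m n} → q ↦ m → m ≡ n → q ↦ n
    ↦-≡ q↦m refl = q↦m

    ↦-+ : ∀ {q r m n} → q ↦ m → r ↦ n → q ℚ.+ r ↦ m + n
    ↦-+ {q} {r} {m} {n} (reduction u v v≉0 qv u≈) (reduction u′ v′ v′≉0 rv u′≈) =
      reduction (u * v′ + u′ * v) (v * v′) (*-≉0 v≉0 v′≉0) fraction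
        (≈-trans (+-cong (*-congʳ v′ u≈) (*-congʳ v u′≈)) (≈-reflexive (collect m n v v′)))
      where
      open ≡-Reasoning
      collect : ∀ m n v v′ → m * v * v′ + n * v′ * v ≡ (m + n) * (v * v′)
      collect = solve-∀
      fraction : (q ℚ.+ r) ℚ.* embed (v * v′) ≡ embed (u * v′ + u′ * v)
      fraction = begin
        (q ℚ.+ r) ℚ.* embed (v * v′)             ≡⟨ cong ((q ℚ.+ r) ℚ.*_) (embed-* v v′) ⟨
        (q ℚ.+ r) ℚ.* (embed v ℚ.* embed v′)
          ≡⟨ +-*-Solver.solve 4 (λ q r v w → (q :+ r) :* (v :* w) := (q :* v) :* w :+ (r :* w) :* v) refl q r (embed v) (embed v′) ⟩
        (q ℚ.* embed v) ℚ.* embed v′ ℚ.+ (r ℚ.* embed v′) ℚ.* embed v  ≡⟨ cong₂ (λ s t → s ℚ.* embed v′ ℚ.+ t ℚ.* embed v) qv rv ⟩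
        embed u ℚ.* embed v′ ℚ.+ embed u′ ℚ.* embed v                  ≡⟨ cong₂ ℚ._+_ (embed-* u v′) (embed-* u′ v) ⟩
        embed (u * v′) ℚ.+ embed (u′ * v)                              ≡⟨ embed-+ (u * v′) (u′ * v) ⟩
        embed (u * v′ + u′ * v)                                        ∎
        where open +-*-Solver using (_:+_; _:*_; _:=_)

    ↦-* : ∀ {q r m n} → q ↦ m → r ↦ n → q ℚ.* r ↦ m * n
    ↦-* {q} {r} {m} {n} (reduction u v v≉0 qv u≈) (reduction u′ v′ v′≉0 rv u′≈) =
      reduction (u * u′) (v * v′) (*-≉0 v≉0 v′≉0) fraction
        (≈-trans (*-cong u≈ u′≈) (≈-reflexive (collect m n v v′)))
      where
      open ≡-Reasoning
      collect : ∀ m n v v′ → m * v * (n * v′) ≡ m * n * (v * v′)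
      collect = solve-∀
      fraction : q ℚ.* r ℚ.* embed (v * v′) ≡ embed (u * u′)
      fraction = begin
        q ℚ.* r ℚ.* embed (v * v′)                ≡⟨ cong (q ℚ.* r ℚ.*_) (embed-* v v′) ⟨
        q ℚ.* r ℚ.* (embed v ℚ.* embed v′)
          ≡⟨ +-*-Solver.solve 4 (λ q r v w → q :* r :* (v :* w) := (q :* v) :* (r :* w)) refl q r (embed v) (embed v′) ⟩
        (q ℚ.* embed v) ℚ.* (r ℚ.* embed v′)      ≡⟨ cong₂ ℚ._*_ qv rv ⟩
        embed u ℚ.* embed u′                      ≡⟨ embed-* u u′ ⟩
        embed (u * u′)                            ∎
        where open +-*-Solver using (_:*_; _:=_)

    ↦-neg : ∀ {q n} → q ↦ n → ℚ.- q ↦ - n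
    ↦-neg {q} {n} (reduction u v v≉0 qv u≈) =
      reduction (- u) v v≉0
        (trans (sym (ℚₚ.neg-distribˡ-* q (embed v))) (trans (cong ℚ.-_ qv) (embed-neg u)))
        (≈-trans (neg-cong u≈) (≈-reflexive (ℤₚ.neg-distribˡ-* n v)))

    ↦-- : ∀ {q r m n} → q ↦ m → r ↦ n → q ℚ.- r ↦ m - n
    ↦-- q↦m r↦n = ↦-+ q↦m (↦-neg r↦n)

    ↦-^ : ∀ {q n} k → q ↦ n → q D.^ k ↦ n ^ k
    ↦-^ zero    q↦n = ↦-embed 1ℤ
    ↦-^ {n = n} (suc k) q↦n = ↦-≡ (↦-* (↦-^ k q↦n) q↦n) (ℤₚ.*-comm (n ^ k) n)

    ↦-Σ : ∀ {f g} n → (∀ k → k ℕ.< n → f k ↦ g k) → D.Σ< n f ↦ Σℤ n g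
    ↦-Σ zero    f↦g = ↦-embed 0ℤ
    ↦-Σ (suc n) f↦g = ↦-+ (↦-Σ n (λ k k<n → f↦g k (ℕₚ.m<n⇒m<1+n k<n))) (f↦g n (ℕₚ.n<1+n n))

    -- Serves the divisions by `suc k` inside `binom`: a rational may be reduced after
    -- multiplication by a unit.
    ↦-divide : ∀ {q m} s {n} → ¬ s ≈ 0ℤ → q ℚ.* embed s ↦ n → n ≈ s * m → q ↦ m
    ↦-divide {q} {m} s {n} s≉0 (reduction u v v≉0 qsv u≈) n≈sm =
      reduction u (s * v) (*-≉0 s≉0 v≉0)
        (trans (cong (q ℚ.*_) (sym (embed-* s v))) (trans (sym (ℚₚ.*-assoc q (embed s) (embed v))) qsv))
        (≈-trans u≈ (≈-trans (*-congʳ v n≈sm) (≈-reflexive (swap s m v))))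
      where
      swap : ∀ s m v → s * m * v ≡ m * (s * v)
      swap = solve-∀

    -- Cross-multiplying an arbitrary fraction u/v for q with the reduced one gives v times the
    -- reduced numerator = u times the reduced denominator; p divides u and not v, so it divides the
    -- reduced numerator.
    ↦0⇒num≈0 : ∀ {q n} → q ↦ n → n ≈ 0ℤ → p ℕ∣.∣ ∣ ↥ q ∣
    ↦0⇒num≈0 {q} {n} (reduction u v v≉0 qv u≈) n≈0 = ≈0⇒∣ (≈-cancel v v≉0
      (≈-trans (≈-reflexive crossed) (≈-trans (*-congʳ (↧ q) (≈-trans u≈ (*-congʳ v n≈0))) (≈-reflexive (sym (ℤₚ.*-zeroʳ v))))))
      where
      crossed : v * ↥ q ≡ u * ↧ q
      crossed = embed-injective (begin
        embed (v * ↥ q)                      ≡⟨ embed-* v (↥ q) ⟨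
        embed v ℚ.* embed (↥ q)              ≡⟨ cong (embed v ℚ.*_) (*-denominator q) ⟨
        embed v ℚ.* (q ℚ.* embed (↧ q))      ≡⟨ ℚₚ.*-assoc (embed v) q (embed (↧ q)) ⟨
        embed v ℚ.* q ℚ.* embed (↧ q)        ≡⟨ cong (ℚ._* embed (↧ q)) (trans (ℚₚ.*-comm (embed v) q) qv) ⟩
        embed u ℚ.* embed (↧ q)              ≡⟨ embed-* u (↧ q) ⟩
        embed (u * ↧ q)                      ∎)
        where open ≡-Reasoning

    ↦⇒≡mod : ∀ {a b m n} → a ↦ m → b ↦ n → m ≈ n → D._≡_[mod_] a b p
    ↦⇒≡mod a↦m b↦n m≈n = ↦0⇒num≈0 (↦-- a↦m b↦n) (≈⇒-≈0 m≈n)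

    ↦-exists : ∀ q → D.InZp p q → ∃ λ a → (a ℕ.< p) × (q ↦ + a)
    ↦-exists q p∤d with inverse (↧ q) (λ d≈0 → p∤d (≈0⇒∣ d≈0))
    ... | d⁻¹ , dd⁻¹≈1 with residue (↥ q * d⁻¹)
    ...   | a , a<p , nd⁻¹≈a = a , a<p , ↦-≈ (reduction (↥ q) (↧ q) (λ d≈0 → p∤d (≈0⇒∣ d≈0)) (*-denominator q)
              (≈-sym (begin
                ↥ q * d⁻¹ * ↧ q     ≡⟨ swap (↥ q) d⁻¹ (↧ q) ⟩
                ↥ q * (↧ q * d⁻¹)   ≈⟨ *-congˡ (↥ q) dd⁻¹≈1 ⟩
                ↥ q * 1ℤ            ≡⟨ ℤₚ.*-identityʳ (↥ q) ⟩
                ↥ q                 ∎))) nd⁻¹≈a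
      where
      open SetoidReasoning ≈-setoid
      swap : ∀ x y z → x * y * z ≡ x * (z * y)
      swap = solve-∀

    -- An invertible residue forces q to be nonzero, so the default value of `inv` at zero is never
    -- met, and the fraction u/v simply turns over.
    ↦-inv : ∀ {q n n⁻¹} → q ↦ n → n * n⁻¹ ≈ 1ℤ → D.inv q ↦ n⁻¹
    ↦-inv {q} {n} {n⁻¹} (reduction u v v≉0 qv u≈) nn⁻¹≈1 =
      reduction v u u≉0 (trans (cong (D.inv q ℚ.*_) (sym qv))
        (trans (sym (ℚₚ.*-assoc (D.inv q) q (embed v))) (trans (cong (ℚ._* embed v) (inv-* q≢0)) (ℚₚ.*-identityˡ (embed v)))))
        v≈
      where
      open SetoidReasoning ≈-setoid
      swap : ∀ x y z → x * (y * z) ≡ y * x * z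
      swap = solve-∀
      v≈ : v ≈ n⁻¹ * u
      v≈ = ≈-sym (begin
        n⁻¹ * u          ≈⟨ *-congˡ n⁻¹ u≈ ⟩
        n⁻¹ * (n * v)    ≡⟨ swap n⁻¹ n v ⟩
        n * n⁻¹ * v      ≈⟨ *-congʳ v nn⁻¹≈1 ⟩
        1ℤ * v           ≡⟨ ℤₚ.*-identityˡ v ⟩
        v                ∎)
      u≉0 : ¬ u ≈ 0ℤ
      u≉0 u≈0 = v≉0 (≈-trans v≈ (≈-trans (*-congˡ n⁻¹ u≈0) (≈-reflexive (ℤₚ.*-zeroʳ n⁻¹))))
      q≢0 : ¬ q ≡ 0ℚ
      q≢0 refl = u≉0 (≈-reflexive (embed-injective (trans (sym qv) (ℚₚ.*-zeroˡ (embed v)))))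

    ^-inverse : ∀ {x y} k → x * y ≈ 1ℤ → x ^ k * y ^ k ≈ 1ℤ
    ^-inverse {x} {y} k xy≈1 = ≈-trans (≈-reflexive (sym (^-distrib-* x y k)))
      (≈-trans (^-cong k xy≈1) (≈-reflexive (ℤₚ.^-zeroˡ k)))

    ↦-inv-^ : ∀ {q n n⁻¹} k → q ↦ n → n * n⁻¹ ≈ 1ℤ → D.inv (q D.^ k) ↦ n⁻¹ ^ k
    ↦-inv-^ k q↦n nn⁻¹≈1 = ↦-inv (↦-^ k q↦n) (^-inverse k nn⁻¹≈1)

    -- For k < p the divisors 1, ..., k are units modulo p, hence the coefficient depends only on
    -- the class of x.
    ↦-binom : ∀ {x a} k → x ↦ + a → k ℕ.< p → D.binom x k ↦ bin a k
    ↦-binom zero x↦a _ = ↦-embed 1ℤ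
    ↦-binom {x} {a} (suc k) x↦a k<p = ↦-divide (+ suc k) (small≉0 (s≤s z≤n) k<p)
      (subst (_↦ bin a k * (+ a - + k)) (unscaled k (D.binom x k ℚ.* (x ℚ.- D.ι k)))
        (↦-* (↦-binom k x↦a (ℕₚ.<-trans (ℕₚ.n<1+n k) k<p)) (↦-- x↦a (↦-embed (+ k)))))
      (≈-reflexive (trans (ℤₚ.*-comm (bin a k) (+ a - + k)) (sym (bin-step-k a k))))

    -- Upper negation: each new factor -1-a-k is -(a+k+1), the numerator by which C(a+k,k) grows
    -- when k increases.
    ↦-binom-reflected : ∀ {x a} k → x ↦ + a → k ℕ.< p → D.binom (ℚ.- 1ℚ ℚ.- x) k ↦ (- 1ℤ) ^ k * bin (a ℕ.+ k) k
    ↦-binom-reflected zero x↦a _ = ↦-embed 1ℤ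
    ↦-binom-reflected {x} {a} (suc k) x↦a k<p = ↦-divide (+ suc k) (small≉0 (s≤s z≤n) k<p)
      (subst (_↦ (- 1ℤ) ^ k * bin (a ℕ.+ k) k * (- 1ℤ - + a - + k)) (unscaled k (D.binom (ℚ.- 1ℚ ℚ.- x) k ℚ.* (ℚ.- 1ℚ ℚ.- x ℚ.- D.ι k)))
        (↦-* (↦-binom-reflected k x↦a (ℕₚ.<-trans (ℕₚ.n<1+n k) k<p)) (↦-- (↦-- (↦-embed (- 1ℤ)) x↦a) (↦-embed (+ k)))))
      (≈-reflexive (begin
        (- 1ℤ) ^ k * bin (a ℕ.+ k) k * (- 1ℤ - + a - + k)         ≡⟨ regroup ((- 1ℤ) ^ k) (bin (a ℕ.+ k) k) (+ a) (+ k) ⟩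
        (- 1ℤ) ^ suc k * (+ suc (a ℕ.+ k) * bin (a ℕ.+ k) k)      ≡⟨ cong ((- 1ℤ) ^ suc k *_) (absorption (a ℕ.+ k) k) ⟨
        (- 1ℤ) ^ suc k * (+ suc k * bin (suc (a ℕ.+ k)) (suc k))  ≡⟨ cong (λ n → (- 1ℤ) ^ suc k * (+ suc k * bin n (suc k))) (ℕₚ.+-suc a k) ⟨
        (- 1ℤ) ^ suc k * (+ suc k * bin (a ℕ.+ suc k) (suc k))    ≡⟨ swap ((- 1ℤ) ^ suc k) (+ suc k) (bin (a ℕ.+ suc k) (suc k)) ⟩
        + suc k * ((- 1ℤ) ^ suc k * bin (a ℕ.+ suc k) (suc k))    ∎))
      where
      open ≡-Reasoning
      regroup : ∀ s b a k → s * b * (- 1ℤ - a - k) ≡ - 1ℤ * s * ((1ℤ + (a + k)) * b)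
      regroup = solve-∀
      swap : ∀ x y z → x * (y * z) ≡ y * (x * z)
      swap = solve-∀

    sign-square : ∀ k → (- 1ℤ) ^ k * (- 1ℤ) ^ k ≡ 1ℤ
    sign-square k = trans (sym (^-distrib-* (- 1ℤ) (- 1ℤ) k)) (ℤₚ.^-zeroˡ k)

    ↦-G : ∀ {x a} n → x ↦ + a → n ℕ.< p → D.G n x ↦ gSum a n
    ↦-G {x} {a} n x↦a n<p = ↦-Σ (suc n) (λ k k≤n → let k<p = ℕₚ.<-≤-trans k≤n n<p in
      ↦-≡ (↦-* (↦-* (↦-* (↦-embed (bin n k)) (↦-^ k (↦-embed (- 1ℤ)))) (↦-binom k x↦a k<p)) (↦-binom-reflected k x↦a k<p))
          (trans (regroup (bin n k) ((- 1ℤ) ^ k) (bin a k) (bin (a ℕ.+ k) k))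
                 (trans (cong (bin n k * leg a k *_) (sign-square k)) (ℤₚ.*-identityʳ _))))
      where
      regroup : ∀ c s x y → c * s * x * (s * y) ≡ c * (x * y) * (s * s)
      regroup = solve-∀

    ↦-V : ∀ {x a} n → x ↦ + a → n ℕ.< p → D.V n x ↦ vSum a n
    ↦-V {x} {a} n x↦a n<p = ↦-Σ (suc n) (λ k k≤n → let k<p = ℕₚ.<-≤-trans k≤n n<p in
      ↦-≡ (↦-* (↦-* (↦-* (↦-* (↦-embed (bin n k)) (↦-embed (bin (n ℕ.+ k) k))) (↦-^ k (↦-embed (- 1ℤ))))
                 (↦-binom k x↦a k<p)) (↦-binom-reflected k x↦a k<p))
          (trans (regroup (bin n k) (bin (n ℕ.+ k) k) ((- 1ℤ) ^ k) (bin a k) (bin (a ℕ.+ k) k))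
                 (trans (cong (bin n k * bin (n ℕ.+ k) k * leg a k *_) (sign-square k)) (ℤₚ.*-identityʳ _))))
      where
      regroup : ∀ c d s x y → c * d * s * x * (s * y) ≡ c * d * (x * y) * (s * s)
      regroup = solve-∀

    -- From the integer congruences to the rational chains.

    -- One statement for all four chains, with m/c in the role of m: c = 1 for general x, and c =
    -- 27, 64, 432 otherwise. The denominator is c (2 - m/c - c/m) = 2c - m - c²/m; the resulting
    -- power of c, together with the sign from C(-1-a,k), is the `(- c) ^ k` required of `l`.
    chain : ∀ m q b s c a (f g l : ℕ → ℚ) → m ↦ b → b * s ≈ 1ℤ → ¬ b ≈ c → a ℕ.< p →
            q ↦ + 2 * c - b - c * c * s →
            (∀ n → n ℕ.< p → f n ↦ c ^ n * vSum a n) →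
            (∀ n → n ℕ.< p → g n ↦ c ^ n * gSum a n) →
            (∀ k → k ℕ.< p → l k ↦ central k * ((- c) ^ k * leg a k)) →
            D.Chain p (D.Σ< p (λ n → f n ℚ.* D.inv (m D.^ n)))
                      (D.Σ< p (λ n → g n ℚ.* D.inv (m D.^ n)) D.^ 2)
                      (D.Σ< p (λ k → l k ℚ.* D.inv (q D.^ k)))
    chain m q b s c a f g l m↦b bs≈1 b≉c a<p q↦ f↦ g↦ l↦ =
      ↦⇒≡mod (series f (vSum a) f↦) square (≈-trans (vSums≈ a) (≈-sym (gSums-squared≈ a a<p))) ,
      ↦⇒≡mod square third (gSums-squared≈ a a<p)
      where
      open SetoidReasoning ≈-setoid
      t : ℤ
      t = c * s
      -- Since t = c/m, the hypothesis that m and c are incongruent says exactly that 1 - t is a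
      -- unit.
      1-t≉0 : ¬ 1ℤ - t ≈ 0ℤ
      1-t≉0 1-t≈0 = b≉c (begin
        b            ≡⟨ expand b s c ⟩
        c * (b * s) + b * (1ℤ - t)   ≈⟨ +-cong (*-congˡ c bs≈1) (*-congˡ b 1-t≈0) ⟩
        c * 1ℤ + b * 0ℤ              ≡⟨ collect c b ⟩
        c            ∎)
        where
        expand : ∀ b s c → b ≡ c * (b * s) + b * (1ℤ - c * s)
        expand = solve-∀
        collect : ∀ c b → c * 1ℤ + b * 0ℤ ≡ c
        collect = solve-∀
      w : ℤ
      w = proj₁ (inverse (1ℤ - t) 1-t≉0)
      inverts : (1ℤ - t) * w ≈ 1ℤ
      inverts = proj₂ (inverse (1ℤ - t) 1-t≉0)
      open Sums t w inverts
      series : ∀ f F → (∀ n → n ℕ.< p → f n ↦ c ^ n * F n) → D.Σ< p (λ n → f n ℚ.* D.inv (m D.^ n)) ↦ poly p F t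
      series f F f↦ = ↦-Σ p (λ n n<p → ↦-≡ (↦-* (f↦ n n<p) (↦-inv-^ n m↦b bs≈1))
        (trans (regroup (c ^ n) (F n) (s ^ n)) (cong (F n *_) (sym (^-distrib-* c s n)))))
        where
        regroup : ∀ c f s → c * f * s ≡ f * (c * s)
        regroup = solve-∀
      square : D.Σ< p (λ n → g n ℚ.* D.inv (m D.^ n)) D.^ 2 ↦ poly p (gSum a) t * poly p (gSum a) t
      square = ↦-≡ (↦-^ 2 (series g (gSum a) g↦)) (cong (poly p (gSum a) t *_) (ℤₚ.*-identityʳ (poly p (gSum a) t)))
      q⁻¹ : ℤ
      q⁻¹ = - (s * (w * w))
      -- 2c − b − c²s = −b (1 − cs)² because bs = 1.
      q-inverse : (+ 2 * c - b - c * c * s) * q⁻¹ ≈ 1ℤ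
      q-inverse = begin
        (+ 2 * c - b - c * c * s) * q⁻¹
          ≡⟨ expand b c s w ⟩
        b * s * (w * w) + (t * t - + 2 * t) * (w * w)
          ≈⟨ +-cong (*-congʳ (w * w) bs≈1) (≈-refl {(t * t - + 2 * t) * (w * w)}) ⟩
        1ℤ * (w * w) + (t * t - + 2 * t) * (w * w)
          ≡⟨ collect t w ⟩
        ((1ℤ - t) * w) * ((1ℤ - t) * w)
          ≈⟨ *-cong inverts inverts ⟩
        1ℤ ∎
        where
        expand : ∀ b c s w → (+ 2 * c - b - c * c * s) * - (s * (w * w))
                 ≡ b * s * (w * w) + (c * s * (c * s) - + 2 * (c * s)) * (w * w)
        expand = solve-∀
        collect : ∀ t w → 1ℤ * (w * w) + (t * t - + 2 * t) * (w * w) ≡ ((1ℤ - t) * w) * ((1ℤ - t) * w)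
        collect = solve-∀
      -- The two minus signs cancel: `- c` times `q⁻¹` is c s w² = t w · w, the argument y w of H.
      third : D.Σ< p (λ k → l k ℚ.* D.inv (q D.^ k)) ↦ H p a (y * w)
      third = ↦-Σ p (λ k k<p → ↦-≡ (↦-* (l↦ k k<p) (↦-inv-^ k q↦ q-inverse))
        (trans (regroup (central k) ((- c) ^ k) (leg a k) (q⁻¹ ^ k))
               (cong (h a k *_) (trans (sym (^-distrib-* (- c) q⁻¹ k)) (cong (_^ k) (signs c s w))))))
        where
        regroup : ∀ x c l q → x * (c * l) * q ≡ x * l * (c * q)
        regroup = solve-∀
        signs : ∀ c s w → - c * - (s * (w * w)) ≡ c * s * w * w
        signs = solve-∀

    ≉-of-≢mod : ∀ {m b c n} → m ↦ b → c ↦ n → ¬ D._≡_[mod_] m c p → ¬ b ≈ n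
    ≉-of-≢mod m↦b c↦n m≢c b≈n = m≢c (↦⇒≡mod m↦b c↦n b≈n)

    general-residues : ∀ m x b s a → m ↦ b → b * s ≈ 1ℤ → ¬ b ≈ 1ℤ → a ℕ.< p → x ↦ + a →
      D.Chain p (D.Σ< p (λ n → D.V n x ℚ.* D.inv (m D.^ n)))
                (D.Σ< p (λ k → D.G k x ℚ.* D.inv (m D.^ k)) D.^ 2)
                (D.Σ< p (λ k → D.ι ((2 ℕ.* k) C k) ℚ.* D.binom x k ℚ.* D.binom (ℚ.- 1ℚ ℚ.- x) k
                                 ℚ.* D.inv ((D.ι 2 ℚ.- m ℚ.- D.inv m) D.^ k)))
    general-residues m x b s a m↦b bs≈1 b≉1 a<p x↦a =
      chain m (D.ι 2 ℚ.- m ℚ.- D.inv m) b s 1ℤ a (λ n → D.V n x) (λ n → D.G n x)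
          (λ k → D.ι ((2 ℕ.* k) C k) ℚ.* D.binom x k ℚ.* D.binom (ℚ.- 1ℚ ℚ.- x) k) m↦b bs≈1 b≉1 a<p
          (↦-≡ (↦-- (↦-- (↦-embed (+ 2)) m↦b) (↦-inv m↦b bs≈1)) (one b s))
          (λ n n<p → ↦-≡ (↦-V n x↦a n<p) (unit n (vSum a n)))
          (λ n n<p → ↦-≡ (↦-G n x↦a n<p) (unit n (gSum a n)))
          (λ k k<p → ↦-≡ (↦-* (↦-* (↦-embed (central k)) (↦-binom k x↦a k<p)) (↦-binom-reflected k x↦a k<p))
                         (regroup (central k) (bin a k) ((- 1ℤ) ^ k) (bin (a ℕ.+ k) k)))
      where
      one : ∀ b s → + 2 - b - s ≡ + 2 * 1ℤ - b - 1ℤ * 1ℤ * s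
      one = solve-∀
      unit : ∀ n z → z ≡ 1ℤ ^ n * z
      unit n z = sym (trans (cong (_* z) (ℤₚ.^-zeroˡ n)) (ℤₚ.*-identityˡ z))
      regroup : ∀ c x s y → c * x * (s * y) ≡ c * (s * (x * y))
      regroup = solve-∀

    general : ∀ m x → D.InZp p m → D.InZp p x → ¬ D._≡_[mod_] m 0ℚ p → ¬ D._≡_[mod_] m 1ℚ p →
      D.Chain p (D.Σ< p (λ n → D.V n x ℚ.* D.inv (m D.^ n)))
                (D.Σ< p (λ k → D.G k x ℚ.* D.inv (m D.^ k)) D.^ 2)
                (D.Σ< p (λ k → D.ι ((2 ℕ.* k) C k) ℚ.* D.binom x k ℚ.* D.binom (ℚ.- 1ℚ ℚ.- x) k
                                 ℚ.* D.inv ((D.ι 2 ℚ.- m ℚ.- D.inv m) D.^ k)))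
    general m x m∈ℤₚ x∈ℤₚ m≢0 m≢1 =
      let b , _ , m↦b = ↦-exists m m∈ℤₚ
          a , a<p , x↦a = ↦-exists x x∈ℤₚ
          s , bs≈1 = inverse (+ b) (≉-of-≢mod m↦b (↦-embed 0ℤ) m≢0)
      in general-residues m x (+ b) s a m↦b bs≈1 (≉-of-≢mod m↦b (↦-embed 1ℤ) m≢1) a<p x↦a

    -- The special values x = -1/r.

    -- Both sides start at 1 and satisfy the same first-order recurrence modulo p; as k+1 < p in
    -- each step, its leading factor (k+1)² can be cancelled. This compares the binomial products
    -- with the residues directly, without evaluating binomials of fractions.
    leg-unique : ∀ c a (w : ℕ → ℤ) (ρ : ℤ → ℤ) → w 0 ≡ 1ℤ →
      (∀ k → + suc k * + suc k * w (suc k) ≡ ρ (+ k) * w k) →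
      (∀ k → - c * ((+ a - k) * (+ a + k + 1ℤ)) ≈ ρ k) →
      ∀ k → k ℕ.< p → w k ≈ (- c) ^ k * leg a k
    leg-unique c a w ρ w₀ w-step rates zero    _   = ≈-reflexive w₀
    leg-unique c a w ρ w₀ w-step rates (suc k) k<p = ≈-cancel K (small≉0 (s≤s z≤n) k<p) (≈-cancel K (small≉0 (s≤s z≤n) k<p) (begin
      K * (K * w (suc k))                                        ≡⟨ ℤₚ.*-assoc K K (w (suc k)) ⟨
      K * K * w (suc k)                                          ≡⟨ w-step k ⟩
      ρ (+ k) * w k                                              ≈⟨ *-cong (≈-sym (rates (+ k))) (leg-unique c a w ρ w₀ w-step rates k (ℕₚ.<-trans (ℕₚ.n<1+n k) k<p)) ⟩
      - c * ((+ a - + k) * (+ a + + k + 1ℤ)) * ((- c) ^ k * leg a k) ≡⟨ regroup (- c) ((+ a - + k) * (+ a + + k + 1ℤ)) ((- c) ^ k) (leg a k) ⟩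
      (- c) ^ suc k * ((+ a - + k) * (+ a + + k + 1ℤ) * leg a k) ≡⟨ cong ((- c) ^ suc k *_) (leg-step-k a k) ⟨
      (- c) ^ suc k * (K * K * leg a (suc k))                    ≡⟨ swap ((- c) ^ suc k) K (leg a (suc k)) ⟩
      K * (K * ((- c) ^ suc k * leg a (suc k)))                  ∎))
      where
      open SetoidReasoning ≈-setoid
      K = + suc k
      regroup : ∀ c r d l → c * r * (d * l) ≡ c * d * (r * l)
      regroup = solve-∀
      swap : ∀ c k l → c * (k * k * l) ≡ k * (k * (c * l))
      swap = solve-∀

    -- Here `suc r` is the r of the theorem, so that `r` itself is the constant in the factor rk +
    -- (r-1) of the term ratio. The numbers are d = c/r², e = 2c and f = c², and a is the residue of
    -- -1/r.
    special-residues : ∀ r d c e f (w : ℕ → ℤ) (l : ℕ → ℕ) →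
      + c ≡ + d * (+ suc r * + suc r) → + e ≡ + 2 * + c → + f ≡ + c * + c → w 0 ≡ 1ℤ →
      (∀ k → + suc k * + suc k * w (suc k) ≡ + d * (+ suc r * + k + 1ℤ) * (+ suc r * + k + + r) * w k) →
      (∀ k → + l k ≡ central k * w k) →
      ∀ m b s r⁻¹ a → m ↦ b → b * s ≈ 1ℤ → ¬ b ≈ + c → + suc r * r⁻¹ ≈ 1ℤ → a ℕ.< p → - r⁻¹ ≈ + a →
      D.Chain p (D.Σ< p (λ n → D.Vr (suc r) c n ℚ.* D.inv (m D.^ n)))
                (D.Σ< p (λ n → D.Gr (suc r) c n ℚ.* D.inv (m D.^ n)) D.^ 2)
                (D.Σ< p (λ k → D.ι (l k) ℚ.* D.inv ((D.ι e ℚ.- m ℚ.- D.ι f ℚ.* D.inv m) D.^ k)))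
    special-residues r d c e f w l c≡ e≡ f≡ w₀ w-step l≡ m b s r⁻¹ a m↦b bs≈1 b≉c rr⁻¹≈1 a<p -r⁻¹≈a =
      chain m (D.ι e ℚ.- m ℚ.- D.ι f ℚ.* D.inv m) b s (+ c) a (D.Vr (suc r) c) (D.Gr (suc r) c) (λ k → D.ι (l k)) m↦b bs≈1 b≉c a<p
          (↦-≡ (↦-- (↦-- (↦-embed (+ e)) m↦b) (↦-* (↦-embed (+ f)) (↦-inv m↦b bs≈1)))
               (cong₂ (λ e f → e - b - f * s) e≡ f≡))
          (λ n n<p → ↦-* (↦-^ n (↦-embed (+ c))) (↦-V n x↦a n<p))
          (λ n n<p → ↦-* (↦-^ n (↦-embed (+ c))) (↦-G n x↦a n<p))
          (λ k k<p → ↦-≈ (↦-≡ (↦-embed (+ l k)) (l≡ k)) (*-congˡ (central k) (leg-unique (+ c) a w ρ w₀ w-step rates k k<p)))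
      where
      open SetoidReasoning ≈-setoid
      ρ : ℤ → ℤ
      ρ k = + d * (+ suc r * k + 1ℤ) * (+ suc r * k + + r)
      x↦a : ℚ.- D.inv (D.ι (suc r)) ↦ + a
      x↦a = ↦-≈ (↦-neg (↦-inv (↦-embed (+ suc r)) rr⁻¹≈1)) -r⁻¹≈a
      ra≈-1 : + suc r * + a + 1ℤ ≈ 0ℤ
      ra≈-1 = begin
        + suc r * + a + 1ℤ              ≈⟨ +-cong (*-congˡ (+ suc r) (≈-sym -r⁻¹≈a)) (≈-sym rr⁻¹≈1) ⟩
        + suc r * - r⁻¹ + + suc r * r⁻¹ ≡⟨ opposite (+ suc r) r⁻¹ ⟩
        0ℤ                              ∎
        where
        opposite : ∀ r s → r * - s + r * s ≡ 0ℤ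
        opposite = solve-∀
      -- From (r + 1) a ≡ −1 and c = d (r + 1)².
      rates : ∀ k → - + c * ((+ a - k) * (+ a + k + 1ℤ)) ≈ ρ k
      rates k = begin
        - + c * ((+ a - k) * (+ a + k + 1ℤ))
          ≡⟨ cong (λ c → - c * ((+ a - k) * (+ a + k + 1ℤ))) c≡ ⟩
        - (+ d * (+ suc r * + suc r)) * ((+ a - k) * (+ a + k + 1ℤ))
          ≡⟨ expand (+ d) (+ r) (+ a) k ⟩
        ρ k + (+ suc r * + a + 1ℤ) * (- + d * (+ suc r * + a + + r))
          ≈⟨ +-cong (≈-refl {ρ k}) (*-congʳ (- + d * (+ suc r * + a + + r)) ra≈-1) ⟩
        ρ k + 0ℤ
          ≡⟨ ℤₚ.+-identityʳ (ρ k) ⟩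
        ρ k ∎
        where
        expand : ∀ d r a k → - (d * ((1ℤ + r) * (1ℤ + r))) * ((a - k) * (a + k + 1ℤ))
                 ≡ d * ((1ℤ + r) * k + 1ℤ) * ((1ℤ + r) * k + r) + ((1ℤ + r) * a + 1ℤ) * (- d * ((1ℤ + r) * a + r))
        expand = solve-∀

    special : ∀ r d c e f (w : ℕ → ℤ) (l : ℕ → ℕ) → ¬ + suc r ≈ 0ℤ →
      + c ≡ + d * (+ suc r * + suc r) → + e ≡ + 2 * + c → + f ≡ + c * + c → w 0 ≡ 1ℤ →
      (∀ k → + suc k * + suc k * w (suc k) ≡ + d * (+ suc r * + k + 1ℤ) * (+ suc r * + k + + r) * w k) →
      (∀ k → + l k ≡ central k * w k) →
      ∀ m → D.InZp p m → ¬ D._≡_[mod_] m 0ℚ p → ¬ D._≡_[mod_] m (D.ι c) p →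
      D.Chain p (D.Σ< p (λ n → D.Vr (suc r) c n ℚ.* D.inv (m D.^ n)))
                (D.Σ< p (λ n → D.Gr (suc r) c n ℚ.* D.inv (m D.^ n)) D.^ 2)
                (D.Σ< p (λ k → D.ι (l k) ℚ.* D.inv ((D.ι e ℚ.- m ℚ.- D.ι f ℚ.* D.inv m) D.^ k)))
    special r d c e f w l r≉0 c≡ e≡ f≡ w₀ w-step l≡ m m∈ℤₚ m≢0 m≢c =
      let b , _ , m↦b = ↦-exists m m∈ℤₚ
          s , bs≈1 = inverse (+ b) (≉-of-≢mod m↦b (↦-embed 0ℤ) m≢0)
          r⁻¹ , rr⁻¹≈1 = inverse (+ suc r) r≉0
          a , a<p , -r⁻¹≈a = residue (- r⁻¹)
      in special-residues r d c e f w l c≡ e≡ f≡ w₀ w-step l≡ m (+ b) s r⁻¹ a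
           m↦b bs≈1 (≉-of-≢mod m↦b (↦-embed (+ c)) m≢c) rr⁻¹≈1 a<p -r⁻¹≈a

open import Defs
open import Data.Nat using (ℕ; _<_; z<s)
open import Data.Nat.Primality using (Prime)
open import Data.Nat.Combinatorics using (_C_)
open import Data.Product using (_×_; _,_)
open import Relation.Nullary using (¬_)
open import Data.Integer using (+_; 0ℤ)
open import Data.Nat.Properties using (n<1+n; <-trans)
open import Relation.Binary.PropositionalEquality using (refl)
open import Data.Rational using (ℚ; 0ℚ; 1ℚ; _+_; _*_; _-_; -_)

theorem4p8 : (p : ℕ) → Prime p → 3 < p →
    ((m x : ℚ) → InZp p m → InZp p x →
    ¬ (m ≡ 0ℚ [mod p ]) → ¬ (m ≡ 1ℚ [mod p ]) → ¬ (m ≡ - 1ℚ [mod p ]) →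
    Chain p
    (Σ< p (λ n → V n x * inv (m ^ n)))
    (Σ< p (λ k → G k x * inv (m ^ k)) ^ 2)
    (Σ< p (λ k → ι ((2 Data.Nat.* k) C k) * binom x k * binom (- 1ℚ - x) k
    * inv ((ι 2 - m - inv m) ^ k))))
    × ((m : ℚ) → InZp p m →
    ¬ (m ≡ 0ℚ [mod p ]) → ¬ (m ≡ ι 27 [mod p ]) → ¬ (m ≡ - ι 27 [mod p ]) →
    Chain p
    (Σ< p (λ n → Vr 3 27 n * inv (m ^ n)))
    (Σ< p (λ k → Gr 3 27 k * inv (m ^ k)) ^ 2)
    (Σ< p (λ k → ι (((2 Data.Nat.* k) C k) Data.Nat.^ 2 Data.Nat.* ((3 Data.Nat.* k) C k))
    * inv ((ι 54 - m - ι 729 * inv m) ^ k))))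
    × ((m : ℚ) → InZp p m →
    ¬ (m ≡ 0ℚ [mod p ]) → ¬ (m ≡ ι 64 [mod p ]) → ¬ (m ≡ - ι 64 [mod p ]) →
    Chain p
    (Σ< p (λ n → Vr 4 64 n * inv (m ^ n)))
    (Σ< p (λ k → Gr 4 64 k * inv (m ^ k)) ^ 2)
    (Σ< p (λ k → ι (((2 Data.Nat.* k) C k) Data.Nat.^ 2 Data.Nat.* ((4 Data.Nat.* k) C (2 Data.Nat.* k)))
    * inv ((ι 128 - m - ι 4096 * inv m) ^ k))))
    × ((m : ℚ) → InZp p m →
    ¬ (m ≡ 0ℚ [mod p ]) → ¬ (m ≡ ι 432 [mod p ]) → ¬ (m ≡ - ι 432 [mod p ]) →
    Chain p
    (Σ< p (λ n → Vr 6 432 n * inv (m ^ n)))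
    (Σ< p (λ k → Gr 6 432 k * inv (m ^ k)) ^ 2)
    (Σ< p (λ k → ι (((2 Data.Nat.* k) C k) Data.Nat.* ((3 Data.Nat.* k) C k) Data.Nat.* ((6 Data.Nat.* k) C (3 Data.Nat.* k)))
    * inv ((ι 864 - m - ι 186624 * inv m) ^ k))))
theorem4p8 p p-prime 3<p =
    (λ m x m∈ℤₚ x∈ℤₚ m≢0 m≢1 _ → general m x m∈ℤₚ x∈ℤₚ m≢0 m≢1)
  -- In each case the numerals are r-1, c/r², c, 2c and c².
  , (λ m m∈ℤₚ m≢0 m≢27 _ → special 2 3 27 54 729 w₃ l₃ 3≉0
      refl refl refl refl w₃-step binomials₃ m m∈ℤₚ m≢0 m≢27)
  -- The denominators 4 = 2 · 2 and, in the next case, 6 = 2 · 3 are units because p > 3.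
  , (λ m m∈ℤₚ m≢0 m≢64 _ → special 3 4 64 128 4096 w₄ l₄ (*-≉0 2≉0 2≉0)
      refl refl refl refl w₄-step binomials₄ m m∈ℤₚ m≢0 m≢64)
  , (λ m m∈ℤₚ m≢0 m≢432 _ → special 5 12 432 864 186624 w₆ l₆ (*-≉0 2≉0 3≉0)
      refl refl refl refl w₆-step binomials₆ m m∈ℤₚ m≢0 m≢432)
  where
  open Residues
  open Reduction p p-prime
  open Modulo p
  open Field p-prime
  2≉0 : ¬ + 2 ≈ 0ℤ
  2≉0 = small≉0 z<s (<-trans (n<1+n 2) 3<p)
  3≉0 : ¬ + 3 ≈ 0ℤ
  3≉0 = small≉0 z<s 3<p
  l₃ l₄ l₆ : ℕ → ℕ
  l₃ k = ((2 Data.Nat.* k) C k) Data.Nat.^ 2 Data.Nat.* ((3 Data.Nat.* k) C k)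
  l₄ k = ((2 Data.Nat.* k) C k) Data.Nat.^ 2 Data.Nat.* ((4 Data.Nat.* k) C (2 Data.Nat.* k))
  l₆ k = ((2 Data.Nat.* k) C k) Data.Nat.* ((3 Data.Nat.* k) C k) Data.Nat.* ((6 Data.Nat.* k) C (3 Data.Nat.* k))
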